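{- Let $G$ be a simple, finite, connected, undirected partial 2-tree equipped with an edge weight function $w: E(G)\to \mathbb{N}$ and a total order on $V(G)$. Then the set of lex short cycles of $G$ is a minimum cycle basis of $G$.
   Context: A 2-tree is defined inductively: $K_3$ is a 2-tree; if $G'$ is a 2-tree and $G$ is obtained from $G'$ by adding a new vertex $v$ whose neighbourhood in $G$ induces an edge of $G'$, then $G$ is a 2-tree. A partial 2-tree is a subgraph of a 2-tree. For a path $P$, $w(P)=\sum_{e\in E(P)} w(e)$. Given the total order on $V(G)$, a path $P$ between distinct vertices $u,v$ is the lex shortest path if for every other $u$–$v$ path $P'$ exactly one of: (1) $w(P')>w(P)$; (2) $w(P')=w(P)$ and $|E(P')|>|E(P)|$; (3) $w(P')=w(P)$, $|E(P')|=|E(P)|$ and $\min(V(P')\setminus V(P))>\min(V(P)\setminus V(P'))$. It is unique and denoted $lsp(u,v)$. A cycle $C$ is lex short if for every $x,y\in V(C)$, $lsp(x,y)\subseteq C$. The cycle space is the $\mathbb{F}_2$-span of incidence vectors (indexed by $E(G)$) of cycles; a cycle basis is a minimum-size set of cycles whose incidence vectors span the cycle space; the weight of a cycle is the sum of its edge weights; a minimum cycle basis is a cycle basis of minimum total weight. -}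

module Defs where

open import Data.Nat using (ℕ; zero; suc; _+_; _≤_; _<_)
open import Data.Fin using (Fin; zero; suc)
open import Data.Bool using (Bool; if_then_else_; _xor_)
open import Data.Product using (Σ; ∃; ∃-syntax; _×_; _,_; proj₁; proj₂)
open import Data.Sum using (_⊎_)
open import Data.Empty using (⊥)
open import Data.List using (List; []; _∷_; length; map; allFin)
open import Data.Nat.ListAction using (sum)
open import Data.List.Membership.Propositional using (_∈_; _∉_)
open import Data.List.Relation.Unary.All using (All)
open import Data.List.Relation.Unary.Unique.Propositional using (Unique)
open import Data.Vec using (zipWith; lookup)
open import Data.Fin.Subset using (Subset) renaming (_∈_ to _∈ˢ_; ⊥ to ∅)
open import Function.Bundles using (_⇔_)
open import Function.Definitions using (Injective)
open import Relation.Binary.PropositionalEquality using (_≡_; _≢_)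
open import Relation.Nullary using (¬_)

-- 2-trees (inductive definition), with vertex set Fin k.
-- The base is K₃; the step adds a new vertex (here: zero, old vertices
-- are shifted by suc) adjacent exactly to the two ends a, b of an edge.

mutual
  data TwoTree : ℕ → Set where
    K₃  : TwoTree 3
    add : ∀ {k} (T : TwoTree k) (a b : Fin k) → TTAdj T a b → TwoTree (suc k)

  TTAdj : ∀ {k} → TwoTree k → Fin k → Fin k → Set
  TTAdj K₃ x y = x ≢ y
  TTAdj (add T a b _) zero    zero    = ⊥
  TTAdj (add T a b _) zero    (suc y) = (y ≡ a) ⊎ (y ≡ b)
  TTAdj (add T a b _) (suc x) zero    = (x ≡ a) ⊎ (x ≡ b)
  TTAdj (add T a b _) (suc x) (suc y) = TTAdj T x y

-- A finite undirected multigraph-presentation: vertices Fin n, edges Fin m,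
-- edge e has (unordered) ends 'ends e'.

module _ {n m : ℕ} (ends : Fin m → Fin n × Fin n) where

  Joins : Fin m → Fin n → Fin n → Set
  Joins e u v = (ends e ≡ (u , v)) ⊎ (ends e ≡ (v , u))

  Simple : Set
  Simple = (∀ e → proj₁ (ends e) ≢ proj₂ (ends e))
         × (∀ e e′ u v → Joins e u v → Joins e′ u v → e ≡ e′)

  data Walk : Fin n → Fin n → Set where
    []   : ∀ {u} → Walk u u
    cons : ∀ {u x v} (e : Fin m) → Joins e u x → Walk x v → Walk u v

  verts : ∀ {u v} → Walk u v → List (Fin n)
  verts {u} []           = u ∷ []
  verts {u} (cons _ _ W) = u ∷ verts W

  edgesW : ∀ {u v} → Walk u v → List (Fin m)
  edgesW []           = []
  edgesW (cons e _ W) = e ∷ edgesW W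

  IsPath : ∀ {u v} → Walk u v → Set
  IsPath W = Unique (verts W)

  Connected : Set
  Connected = ∀ u v → Walk u v

  PartialTwoTree : Set
  PartialTwoTree = Σ ℕ λ k → Σ (TwoTree k) λ T → Σ (Fin n → Fin k) λ f →
    Injective _≡_ _≡_ f × (∀ e → TTAdj T (f (proj₁ (ends e))) (f (proj₂ (ends e))))

  -- cycles, represented by their edge sets (incidence vectors in 𝔽₂^E)
  -- an edge e from u to x followed by a path from x back to u, of total
  -- length at least 3
  IsCycle : Subset m → Set
  IsCycle S = Σ (Fin n) λ u → Σ (Fin n) λ x → Σ (Fin m) λ e →
    Σ (Joins e u x) λ j → Σ (Walk x u) λ W →
      IsPath W × 2 ≤ length (edgesW W) × (∀ i → (i ∈ˢ S) ⇔ (i ∈ edgesW (cons e j W)))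

  InV : Subset m → Fin n → Set
  InV S x = ∃[ e ] (e ∈ˢ S × ((proj₁ (ends e) ≡ x) ⊎ (proj₂ (ends e) ≡ x)))

  _⊕_ : Subset m → Subset m → Subset m
  _⊕_ = zipWith _xor_

  data Span (P : Subset m → Set) : Subset m → Set where
    span-0 : Span P ∅
    span-+ : ∀ {b v} → P b → Span P v → Span P (b ⊕ v)

  CycleSpace : Subset m → Set
  CycleSpace = Span IsCycle

  IsCycleSet : List (Subset m) → Set
  IsCycleSet B = Unique B × All IsCycle B

  Spans : List (Subset m) → Set
  Spans B = ∀ v → CycleSpace v → Span (_∈ B) v

  IsCycleBasis : List (Subset m) → Set
  IsCycleBasis B = IsCycleSet B × Spans B ×
    (∀ B′ → IsCycleSet B′ → Spans B′ → length B ≤ length B′)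

  module _ (w : Fin m → ℕ) where

    weightW : ∀ {u v} → Walk u v → ℕ
    weightW W = sum (map w (edgesW W))

    cweight : Subset m → ℕ
    cweight S = sum (map (λ e → if lookup S e then w e else 0) (allFin m))

    totalWeight : List (Subset m) → ℕ
    totalWeight B = sum (map cweight B)

    IsMinimumCycleBasis : List (Subset m) → Set
    IsMinimumCycleBasis B = IsCycleBasis B ×
      (∀ B′ → IsCycleBasis B′ → totalWeight B ≤ totalWeight B′)

    module _ (_≺_ : Fin n → Fin n → Set) where

      -- P′ loses against P in one of the three ways (1),(2),(3);
      -- these are mutually exclusive, so "exactly one" = "one of"
      LexBeats : ∀ {u v} → Walk u v → Walk u v → Set
      LexBeats P P′ =
          (weightW P < weightW P′)
        ⊎ ((weightW P′ ≡ weightW P) × (length (edgesW P) < length (edgesW P′)))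
        ⊎ ((weightW P′ ≡ weightW P) × (length (edgesW P′) ≡ length (edgesW P)) ×
            -- min (V(P′) ∖ V(P)) > min (V(P) ∖ V(P′))
            ∃[ x ] (x ∈ verts P × x ∉ verts P′ ×
                    (∀ y → y ∈ verts P′ → y ∉ verts P → x ≺ y)))

      IsLSP : ∀ {u v} → Walk u v → Set
      IsLSP {u} {v} P = u ≢ v × IsPath P ×
        (∀ (P′ : Walk u v) → IsPath P′ → verts P′ ≢ verts P → LexBeats P P′)

      LexShort : Subset m → Set
      LexShort S = ∀ x y → InV S x → InV S y → x ≢ y →
        ∀ (P : Walk x y) → IsLSP P → ∀ e → e ∈ edgesW P → e ∈ˢ S

{-# OPTIONS --safe #-}
module Submission where

-- Perturb the weights so that lex shortest paths become the unique shortest paths for a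
-- positive weight κ.  If the lex shortest path between two vertices of a cycle C leaves C, it
-- cuts C into two κ-smaller closed walks that are no heavier than C; hence every cycle is a
-- sum of lex short cycles no heavier than itself, and by matroid exchange the lex short
-- cycles are a minimum cycle basis as soon as they are linearly independent.  For this all
-- that matters is that they are circuits (minimal non-empty even edge sets) of a 2-tree, and
-- that any two vertices x, y are joined by a path common to all lex short cycles through x and
-- y.  Let v be the last vertex of the 2-tree, attached to the edge ab, and p the common path
-- from a to b.  If p avoids v, then p together with a–v–b is the only one of these cycles
-- through v, and if p passes through v, then the triangle abv is the only one containing the
-- edge ab.  So no member of a vanishing sum passes through v, or none contains ab; replacing
-- a–v–b by ab then gives a vanishing sum in the smaller 2-tree.

open import Defs
open import Algebra.Definitions using (Associative; Commutative)
open import Data.Nat using (ℕ; zero; suc; _+_; _*_; _∸_; _^_; _≤_; _<_; z≤n; s≤s; _≤?_)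
import Data.Nat.Properties as ℕ
open import Data.Nat.ListAction using (sum)
open import Data.Nat.ListAction.Properties using (sum-++; sum-↭)
open import Data.Nat.Solver using (module +-*-Solver)
open import Data.Fin using (Fin; zero; suc; _≟_)
import Data.Fin.Properties as Fin
open import Data.Fin.Subset using (Subset; ⁅_⁆) renaming (⊥ to ∅)
open import Data.Fin.Subset.Properties using (x∈⁅x⁆; x∈⁅y⁆⇒x≡y)
open import Data.Bool using (Bool; true; false; _∧_; _xor_; not; if_then_else_)
import Data.Bool.Properties as 𝔹
open import Data.Product as Product using (Σ; ∃; _×_; _,_; proj₁; proj₂)
open import Data.Sum as Sum using (_⊎_; inj₁; inj₂; [_,_]′)
open import Data.List as List using (List; []; _∷_; _++_; length; map; foldr; allFin)
open import Data.List.Properties using (length-map; map-++; length-++; ∷-injective; ≡-dec)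
open import Data.List.Membership.Propositional using (_∈_; _∉_; find; lose)
open import Data.List.Membership.Propositional.Properties
  using (∈-map⁻; ∈-lookup; ∈-allFin; ∈-++⁺ˡ; ∈-++⁺ʳ)
open import Data.List.Membership.DecPropositional using (_∈?_)
open import Data.List.Relation.Unary.Any as Any using (Any; here; there)
open import Data.List.Relation.Unary.Any.Properties using (lookup-index)
open import Data.List.Relation.Unary.All as All using (All; []; _∷_)
import Data.List.Relation.Unary.All.Properties as All
open import Data.List.Relation.Unary.AllPairs using (AllPairs; []; _∷_)
open import Data.List.Relation.Unary.Unique.Propositional using (Unique)
import Data.List.Relation.Unary.Unique.Propositional.Properties as Unique
open import Data.List.Relation.Binary.Permutation.Propositional as ↭
  using (_↭_; ↭-sym; ↭-trans; ↭-refl; ↭-reflexive)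
import Data.List.Relation.Binary.Permutation.Propositional.Properties as ↭
open import Data.Vec as Vec using (Vec; []; _∷_; zipWith; lookup; tabulate; fromList; _[_]≔_)
import Data.Vec.Properties as Vec
open import Function using (_∘_; id)
open import Function.Bundles using (_⇔_; Equivalence; mk⇔)
open import Function.Definitions using (Injective)
open import Relation.Nullary using (¬_; contradiction; yes; no; does; Dec)
open import Relation.Nullary.Decidable
  using (_×-dec_; _⊎-dec_; map′; dec-true; dec-false; does-⇔)
open import Relation.Binary.Definitions using (tri<; tri≈; tri>)
open import Relation.Binary.PropositionalEquality
open import Relation.Binary.Structures using (IsStrictTotalOrder)

-- Lex shortness speaks of weights and of paths in the given graph, and neither survives the
-- replacement of a-v-b by ab: the edge ab of the 2-tree may be absent from the graph. The induction
-- therefore runs over arbitrary families of circuits in the edge space of the 2-tree, and all it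
-- keeps of lex shortness is the existence of the common chains, a condition on boundaries and
-- inclusions.
--
-- Clause (3) of the lex order compares vertex sets only, so it says nothing about two paths that
-- visit the same vertices in different orders. Positivity of κ closes this gap: two κ-minimal paths
-- with equal ends and equal vertex sets coincide. Positivity also makes κ a termination measure
-- although edges of weight zero are allowed.
--
-- The exchange is carried out on a matrix whose rows are the coordinates of the cycles of a
-- competing basis over the lex short cycles. Each row is at least as heavy as every column in which
-- it has a one. Elimination matches the columns with distinct rows no lighter than themselves,
-- which bounds the size and the total weight at once.

private variable
  m n k : ℕ
  A B : Set

-- Linear algebra over 𝔽₂

infixl 6 _⊞_
_⊞_ : Subset m → Subset m → Subset m
_⊞_ = zipWith _xor_

⊞-assoc : Associative _≡_ (_⊞_ {m})
⊞-assoc = Vec.zipWith-assoc 𝔹.xor-assoc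

⊞-comm : Commutative _≡_ (_⊞_ {m})
⊞-comm = Vec.zipWith-comm 𝔹.xor-comm

⊞-identityˡ : (p : Subset m) → ∅ ⊞ p ≡ p
⊞-identityˡ = Vec.zipWith-identityˡ λ _ → refl

⊞-identityʳ : (p : Subset m) → p ⊞ ∅ ≡ p
⊞-identityʳ = Vec.zipWith-identityʳ 𝔹.xor-identityʳ

⊞-same : (p : Subset m) → p ⊞ p ≡ ∅
⊞-same []      = refl
⊞-same (x ∷ p) = cong₂ _∷_ (𝔹.xor-same x) (⊞-same p)

⊞-cancel : (p q : Subset m) → p ⊞ (p ⊞ q) ≡ q
⊞-cancel p q = begin
  p ⊞ (p ⊞ q)  ≡⟨ ⊞-assoc p p q ⟨
  p ⊞ p ⊞ q    ≡⟨ cong (_⊞ q) (⊞-same p) ⟩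
  ∅ ⊞ q        ≡⟨ ⊞-identityˡ q ⟩
  q            ∎
  where open ≡-Reasoning

⊞-interchange : (p q r s : Subset m) → (p ⊞ q) ⊞ (r ⊞ s) ≡ (p ⊞ r) ⊞ (q ⊞ s)
⊞-interchange p q r s = begin
  (p ⊞ q) ⊞ (r ⊞ s)  ≡⟨ ⊞-assoc p q _ ⟩
  p ⊞ (q ⊞ (r ⊞ s))  ≡⟨ cong (p ⊞_) (⊞-assoc q r s) ⟨
  p ⊞ (q ⊞ r ⊞ s)    ≡⟨ cong (λ ∙ → p ⊞ (∙ ⊞ s)) (⊞-comm q r) ⟩
  p ⊞ (r ⊞ q ⊞ s)    ≡⟨ cong (p ⊞_) (⊞-assoc r q s) ⟩
  p ⊞ (r ⊞ (q ⊞ s))  ≡⟨ ⊞-assoc p r _ ⟨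
  (p ⊞ r) ⊞ (q ⊞ s)  ∎
  where open ≡-Reasoning

infixr 7 _·_
_·_ : Bool → Subset m → Subset m
α · s = if α then s else ∅

·-⊞ : ∀ α β (s : Subset m) → (α xor β) · s ≡ α · s ⊞ β · s
·-⊞ false β     s = sym (⊞-identityˡ _)
·-⊞ true  false s = sym (⊞-identityʳ _)
·-⊞ true  true  s = sym (⊞-same s)

xor-false : ∀ {a b} → a xor b ≡ false → a ≡ b
xor-false {false} {false} _ = refl
xor-false {true}  {true}  _ = refl

lookup-⊞ : (p q : Subset m) (i : Fin m) → lookup (p ⊞ q) i ≡ lookup p i xor lookup q i
lookup-⊞ p q i = Vec.lookup-zipWith _xor_ i p q

lookup-∅ : (i : Fin m) → lookup (∅ {m}) i ≡ false
lookup-∅ i = Vec.lookup-replicate i false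

lookup-ext : {p q : Subset m} → (∀ i → lookup p i ≡ lookup q i) → p ≡ q
lookup-ext {p = p} {q} h =
  trans (sym (Vec.tabulate∘lookup p)) (trans (Vec.tabulate-cong h) (Vec.tabulate∘lookup q))

infix 4 _⊑_
_⊑_ : Subset m → Subset m → Set
p ⊑ q = ∀ i → lookup p i ≡ true → lookup q i ≡ true

bool-ext : ∀ {a b} → (a ≡ true → b ≡ true) → (b ≡ true → a ≡ true) → a ≡ b
bool-ext {false} {false} f g = refl
bool-ext {false} {true}  f g = g refl
bool-ext {true}          f g = sym (f refl)

⊑-antisym : {p q : Subset m} → p ⊑ q → q ⊑ p → p ≡ q
⊑-antisym f g = lookup-ext λ i → bool-ext (f i) (g i)

lookup-⁅⁆ : (i : Fin m) → lookup ⁅ i ⁆ i ≡ true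
lookup-⁅⁆ i = Vec.[]=⇒lookup (x∈⁅x⁆ i)

lookup-⁅⁆⇒≡ : (i : Fin m) {j : Fin m} → lookup ⁅ i ⁆ j ≡ true → j ≡ i
lookup-⁅⁆⇒≡ i {j} eq = x∈⁅y⁆⇒x≡y i (Vec.lookup⇒[]= j _ eq)

lookup-⁅⁆-≢ : {i j : Fin m} → j ≢ i → lookup ⁅ i ⁆ j ≡ false
lookup-⁅⁆-≢ {i = i} {j} j≢i with lookup ⁅ i ⁆ j in eq
... | true  = contradiction (lookup-⁅⁆⇒≡ i eq) j≢i
... | false = refl

⨁ : List (Subset m) → Subset m
⨁ = foldr _⊞_ ∅

-- Counting edges modulo 2 makes concatenation additive and lets an edge traversed twice cancel; on
-- a list without repetitions this is the incidence vector.
mod2 : List (Fin m) → Subset m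
mod2 = ⨁ ∘ map ⁅_⁆

mod2-++ : (xs ys : List (Fin m)) → mod2 (xs ++ ys) ≡ mod2 xs ⊞ mod2 ys
mod2-++ []       ys = sym (⊞-identityˡ _)
mod2-++ (x ∷ xs) ys = trans (cong (⁅ x ⁆ ⊞_) (mod2-++ xs ys)) (sym (⊞-assoc ⁅ x ⁆ _ _))

mod2-↭ : {xs ys : List (Fin m)} → xs ↭ ys → mod2 xs ≡ mod2 ys
mod2-↭ ↭.refl = refl
mod2-↭ (↭.prep x p) = cong (⁅ x ⁆ ⊞_) (mod2-↭ p)
mod2-↭ {xs = x ∷ y ∷ xs} (↭.swap x y p) = begin
  ⁅ x ⁆ ⊞ (⁅ y ⁆ ⊞ mod2 xs)  ≡⟨ ⊞-assoc ⁅ x ⁆ _ _ ⟨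
  ⁅ x ⁆ ⊞ ⁅ y ⁆ ⊞ mod2 xs    ≡⟨ cong₂ _⊞_ (⊞-comm ⁅ x ⁆ _) (mod2-↭ p) ⟩
  ⁅ y ⁆ ⊞ ⁅ x ⁆ ⊞ _          ≡⟨ ⊞-assoc ⁅ y ⁆ _ _ ⟩
  ⁅ y ⁆ ⊞ (⁅ x ⁆ ⊞ _)        ∎
  where open ≡-Reasoning
mod2-↭ (↭.trans p q) = trans (mod2-↭ p) (mod2-↭ q)

mod2⇒∈ : {xs : List (Fin m)} {i : Fin m} → lookup (mod2 xs) i ≡ true → i ∈ xs
mod2⇒∈ {xs = []} {i} eq = contradiction (trans (sym eq) (lookup-∅ i)) λ ()
mod2⇒∈ {xs = x ∷ xs} {i} eq with i Data.Fin.≟ x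
... | yes i≡x = here i≡x
... | no  i≢x = there (mod2⇒∈ (trans
  (sym (trans (lookup-⊞ ⁅ x ⁆ _ i) (cong (_xor lookup (mod2 xs) i) (lookup-⁅⁆-≢ i≢x)))) eq))

∉⇒mod2 : {xs : List (Fin m)} {i : Fin m} → i ∉ xs → lookup (mod2 xs) i ≡ false
∉⇒mod2 {xs = xs} {i} i∉xs with lookup (mod2 xs) i in eq
... | true  = contradiction (mod2⇒∈ eq) i∉xs
... | false = refl

∈⇒mod2 : {xs : List (Fin m)} {i : Fin m} → Unique xs → i ∈ xs → lookup (mod2 xs) i ≡ true
∈⇒mod2 {xs = x ∷ xs} (x∉ ∷ _) (here refl) = trans (lookup-⊞ ⁅ x ⁆ _ x)
  (cong₂ _xor_ (lookup-⁅⁆ x) (∉⇒mod2 λ x∈ → All.lookup x∉ x∈ refl))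
∈⇒mod2 {xs = x ∷ xs} {i} (x∉ ∷ u) (there i∈) = trans (lookup-⊞ ⁅ x ⁆ _ i)
  (cong₂ _xor_ (lookup-⁅⁆-≢ λ i≡x → All.lookup x∉ i∈ (sym i≡x)) (∈⇒mod2 u i∈))

-- Weighted Gaussian elimination

⟨_,_⟩ : Subset k → Subset k → Bool
⟨ [] , [] ⟩ = false
⟨ x ∷ p , y ∷ q ⟩ = (x ∧ y) xor ⟨ p , q ⟩

xor-interchange : ∀ a b c d → (a xor b) xor (c xor d) ≡ (a xor c) xor (b xor d)
xor-interchange false b c d = trans (sym (𝔹.xor-assoc b c d))
  (trans (cong (_xor d) (𝔹.xor-comm b c)) (𝔹.xor-assoc c b d))
xor-interchange true b c d = trans (sym (𝔹.not-distribˡ-xor b _))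
  (trans (cong not (xor-interchange false b c d)) (𝔹.not-distribˡ-xor c _))

⟨⟩-⊞ : (y p q : Subset k) → ⟨ y , p ⊞ q ⟩ ≡ ⟨ y , p ⟩ xor ⟨ y , q ⟩
⟨⟩-⊞ [] [] [] = refl
⟨⟩-⊞ (a ∷ y) (b ∷ p) (c ∷ q) =
  trans (cong₂ _xor_ (𝔹.∧-distribˡ-xor a b c) (⟨⟩-⊞ y p q)) (xor-interchange (a ∧ b) _ _ _)

⟨⟩-∅ : (y : Subset k) → ⟨ y , ∅ ⟩ ≡ false
⟨⟩-∅ [] = refl
⟨⟩-∅ (a ∷ y) = cong₂ _xor_ (𝔹.∧-zeroʳ a) (⟨⟩-∅ y)

∅-⟨⟩ : (y : Subset k) → ⟨ ∅ , y ⟩ ≡ false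
∅-⟨⟩ [] = refl
∅-⟨⟩ (a ∷ y) = ∅-⟨⟩ y

⟨⟩-⁅⁆ : (y : Subset k) (i : Fin k) → ⟨ y , ⁅ i ⁆ ⟩ ≡ lookup y i
⟨⟩-⁅⁆ (a ∷ y) zero = trans (cong₂ _xor_ (𝔹.∧-identityʳ a) (⟨⟩-∅ y)) (𝔹.xor-identityʳ a)
⟨⟩-⁅⁆ (a ∷ y) (suc i) = cong₂ _xor_ (𝔹.∧-zeroʳ a) (⟨⟩-⁅⁆ y i)

-- Stands for a cycle of a competing basis: its coordinates over the candidate basis, and its
-- weight.
Row : ℕ → Set
Row k = Subset k × ℕ

head : Row (suc k) → Bool
head = Vec.head ∘ proj₁

select : (R : List (Row (suc k))) → All (λ r → head r ≡ false) R ⊎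
  ∃ λ b → ∃ λ R′ → R ↭ b ∷ R′ × head b ≡ true × All (λ r → head r ≡ true → proj₂ b ≤ proj₂ r) R′
select [] = inj₁ []
select (r ∷ R) with head r in r₀ | select R
... | false | inj₁ none = inj₁ (r₀ ∷ none)
... | false | inj₂ (b , R′ , R↭ , b₀ , min) =
  inj₂ (b , r ∷ R′ , ↭.trans (↭.prep r R↭) (↭.swap r b ↭.refl) , b₀ ,
    (λ r₀′ → contradiction (trans (sym r₀) r₀′) λ ()) ∷ min)
... | true  | inj₁ none = inj₂ (r , R , ↭.refl , r₀ ,
    All.map (λ h h′ → contradiction (trans (sym h) h′) λ ()) none)
... | true  | inj₂ (b , R′ , R↭ , b₀ , min) with ℕ.≤-total (proj₂ b) (proj₂ r)
...   | inj₁ b≤r = inj₂ (b , r ∷ R′ , ↭.trans (↭.prep r R↭) (↭.swap r b ↭.refl) , b₀ , (λ _ → b≤r) ∷ min)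
...   | inj₂ r≤b = inj₂ (r , b ∷ R′ , ↭.prep r R↭ , r₀ ,
    (λ _ → r≤b) ∷ All.map (λ f h → ℕ.≤-trans r≤b (f h)) min)

eliminate : Row (suc k) → Row (suc k) → Row k
eliminate (b , _) (r , ω) = Vec.tail r ⊞ (if Vec.head r then Vec.tail b else ∅) , ω

-- Gaussian elimination.  Taking the pivot row of least weight keeps the bound of the
-- column weights by the row weights intact.
exchange : (wc : Vec ℕ k) (R : List (Row k)) →
  All (λ r → ∀ i → lookup (proj₁ r) i ≡ true → lookup wc i ≤ proj₂ r) R →
  (∀ y → All (λ r → ⟨ y , proj₁ r ⟩ ≡ false) R → y ≡ ∅) →
  k ≤ length R × Vec.sum wc ≤ sum (map proj₂ R)
exchange [] R _ _ = z≤n , z≤n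
exchange {suc k} (ω₀ ∷ wc) R bounded nondeg with select R
... | inj₁ none = contradiction (nondeg (true ∷ ∅) (All.map (λ {r} → killed r) none)) λ ()
  where
  killed : (r : Row (suc k)) → head r ≡ false → ⟨ true ∷ ∅ , proj₁ r ⟩ ≡ false
  killed (_ ∷ r , _) refl = ∅-⟨⟩ r
... | inj₂ ((true ∷ b , β) , R′ , R↭ , refl , min)
  with (b-bounded ∷ R′-bounded) ← ↭.All-resp-↭ R↭ bounded
  = subst (suc k ≤_) (sym (↭.↭-length R↭)) (s≤s (subst (k ≤_) (length-map _ R′) (proj₁ rec))) ,
    subst (_ ≤_) (sym (sum-↭ (↭.map⁺ proj₂ R↭)))
      (ℕ.+-mono-≤ (b-bounded zero refl) (subst (_ ≤_) (weights R′) (proj₂ rec)))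
  where
  pivot : Row (suc k)
  pivot = true ∷ b , β

  weights : ∀ R → sum (map proj₂ (map (eliminate pivot) R)) ≡ sum (map proj₂ R)
  weights []      = refl
  weights (r ∷ R) = cong (proj₂ r +_) (weights R)

  Bounded : ∀ {k} → Vec ℕ k → Row k → Set
  Bounded wc r = ∀ i → lookup (proj₁ r) i ≡ true → lookup wc i ≤ proj₂ r

  bound : (r : Row (suc k)) → (head r ≡ true → β ≤ proj₂ r) → Bounded (ω₀ ∷ wc) r → Bounded wc (eliminate pivot r)
  bound (false ∷ r , ω) _ h i eq = h (suc i) (trans (sym (cong (λ ∙ → lookup ∙ i) (⊞-identityʳ r))) eq)
  bound (true ∷ r , ω) β≤ h i eq with lookup r i in eq′
  ... | true  = h (suc i) eq′
  -- A one created by elimination comes from the pivot row, whose weight β is at most that of the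
  -- row changed.
  ... | false = ℕ.≤-trans (b-bounded (suc i) (trans (sym (trans (lookup-⊞ r b i)
                  (cong (_xor lookup b i) eq′))) eq)) (β≤ refl)

  -- The first coordinate of the extended functional is forced: it has to cancel ⟨ y , b ⟩ on the
  -- pivot row, whose head is `true`.
  lift : ∀ y (r : Row (suc k)) → ⟨ y , proj₁ (eliminate pivot r) ⟩ ≡ false →
         ⟨ ⟨ y , b ⟩ ∷ y , proj₁ r ⟩ ≡ false
  lift y (false ∷ r , ω) eq = trans (cong (_xor ⟨ y , r ⟩) (𝔹.∧-zeroʳ ⟨ y , b ⟩))
    (trans (sym (cong ⟨ y ,_⟩ (⊞-identityʳ r))) eq)
  lift y (true ∷ r , ω) eq = trans (cong (_xor ⟨ y , r ⟩) (𝔹.∧-identityʳ ⟨ y , b ⟩))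
    (trans (𝔹.xor-comm ⟨ y , b ⟩ _) (trans (sym (⟨⟩-⊞ y r b)) eq))

  rec = exchange wc (map (eliminate pivot) R′)
    (All.map⁺ (All.zipWith (λ {r} (f , h) → bound r f h) (min , R′-bounded)))
    λ y kills → cong Vec.tail (nondeg (⟨ y , b ⟩ ∷ y) (↭.All-resp-↭ (↭-sym R↭)
      (trans (cong (_xor ⟨ y , b ⟩) (𝔹.∧-identityʳ ⟨ y , b ⟩)) (𝔹.xor-same ⟨ y , b ⟩)
        ∷ All.map (λ {r} → lift y r) (All.map⁻ kills))))

-- Independence in 2-trees

-- Serves both as the boundary of an edge and as the boundary required of a chain from p to q; it
-- vanishes for p = q.
inc : Fin n × Fin n → Fin n → Bool
inc (p , q) x = does (p ≟ x) xor does (q ≟ x)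

-- The boundary map over 𝔽₂, that is, the parity of the degree of x.
∂ : (Fin m → Fin n × Fin n) → Subset m → Fin n → Bool
∂ ends []      x = false
∂ ends (s ∷ S) x = (s ∧ inc (ends zero) x) xor ∂ (ends ∘ suc) S x

∂-⊞ : (ends : Fin m → Fin n × Fin n) (p q : Subset m) (x : Fin n) →
      ∂ ends (p ⊞ q) x ≡ ∂ ends p x xor ∂ ends q x
∂-⊞ ends []      []      x = refl
∂-⊞ ends (s ∷ p) (t ∷ q) x = trans
  (cong₂ _xor_ (𝔹.∧-distribʳ-xor (inc (ends zero) x) s t) (∂-⊞ (ends ∘ suc) p q x))
  (xor-interchange (s ∧ _) _ _ _)

∂-∅ : (ends : Fin m → Fin n × Fin n) (x : Fin n) → ∂ ends ∅ x ≡ false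
∂-∅ {zero}  ends x = refl
∂-∅ {suc m} ends x = ∂-∅ (ends ∘ suc) x

∂-⁅⁆ : (ends : Fin m → Fin n × Fin n) (i : Fin m) (x : Fin n) → ∂ ends ⁅ i ⁆ x ≡ inc (ends i) x
∂-⁅⁆ ends zero    x = trans (cong (inc (ends zero) x xor_) (∂-∅ (ends ∘ suc) x)) (𝔹.xor-identityʳ _)
∂-⁅⁆ ends (suc i) x = ∂-⁅⁆ (ends ∘ suc) i x

∂-shift-zero : (ends : Fin m → Fin n × Fin n) (S : Subset m) →
               ∂ (Product.map suc suc ∘ ends) S zero ≡ false
∂-shift-zero ends []      = refl
∂-shift-zero ends (s ∷ S) = cong₂ _xor_ (𝔹.∧-zeroʳ s) (∂-shift-zero (ends ∘ suc) S)

∂-shift-suc : (ends : Fin m → Fin n × Fin n) (S : Subset m) (x : Fin n) →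
              ∂ (Product.map suc suc ∘ ends) S (suc x) ≡ ∂ ends S x
∂-shift-suc ends []      x = refl
∂-shift-suc ends (s ∷ S) x = cong ((s ∧ inc (ends zero) x) xor_) (∂-shift-suc (ends ∘ suc) S x)

inc-joins : (ends : Fin m → Fin n × Fin n) {e : Fin m} {u v : Fin n} →
            Joins ends e u v → inc (ends e) ≗ inc (u , v)
inc-joins ends (inj₁ eq) x = cong (λ ∙ → inc ∙ x) eq
inc-joins ends {u = u} {v} (inj₂ eq) x = trans (cong (λ ∙ → inc ∙ x) eq) (𝔹.xor-comm (does (v ≟ x)) _)

size : TwoTree k → ℕ
size K₃            = 3
size (add T _ _ _) = 2 + size T

-- The two edges at the new vertex come first, so a chain of `add T a b _` has the form α ∷ β ∷ c
-- with c a chain of T.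
tends : (T : TwoTree k) → Fin (size T) → Fin k × Fin k
tends K₃            zero             = suc zero , suc (suc zero)
tends K₃            (suc zero)       = zero , suc (suc zero)
tends K₃            (suc (suc zero)) = zero , suc zero
tends (add T a b _) zero             = zero , suc a
tends (add T a b _) (suc zero)       = zero , suc b
tends (add T a b _) (suc (suc t))    = Product.map suc suc (tends T t)

edge : (T : TwoTree k) {x y : Fin k} → TTAdj T x y → ∃ λ t → Joins (tends T) t x y
edge K₃ {zero}         {zero}         x≢y = contradiction refl x≢y
edge K₃ {zero}         {suc zero}     x≢y = suc (suc zero) , inj₁ refl
edge K₃ {zero}         {suc (suc zero)} x≢y = suc zero , inj₁ refl
edge K₃ {suc zero}     {zero}         x≢y = suc (suc zero) , inj₂ refl
edge K₃ {suc zero}     {suc zero}     x≢y = contradiction refl x≢y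
edge K₃ {suc zero}     {suc (suc zero)} x≢y = zero , inj₁ refl
edge K₃ {suc (suc zero)} {zero}         x≢y = suc zero , inj₂ refl
edge K₃ {suc (suc zero)} {suc zero}     x≢y = zero , inj₂ refl
edge K₃ {suc (suc zero)} {suc (suc zero)} x≢y = contradiction refl x≢y
edge (add T a b _) {zero}  {suc _} (inj₁ refl) = zero , inj₁ refl
edge (add T a b _) {zero}  {suc _} (inj₂ refl) = suc zero , inj₁ refl
edge (add T a b _) {suc _} {zero}  (inj₁ refl) = zero , inj₂ refl
edge (add T a b _) {suc _} {zero}  (inj₂ refl) = suc zero , inj₂ refl
edge (add T a b _) {suc x} {suc y} xy with edge T xy
... | t , inj₁ eq = suc (suc t) , inj₁ (cong (Product.map suc suc) eq)
... | t , inj₂ eq = suc (suc t) , inj₂ (cong (Product.map suc suc) eq)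

Touches : (T : TwoTree k) → Subset (size T) → Fin k → Set
Touches T c x = ∃ λ t → lookup c t ≡ true × (proj₁ (tends T t) ≡ x ⊎ proj₂ (tends T t) ≡ x)

Even : (T : TwoTree k) → Subset (size T) → Set
Even T c = ∀ x → ∂ (tends T) c x ≡ false

-- Minimality takes the place of closed walks, so that only parity and inclusion have to be carried
-- through the contraction.
Circuit : (T : TwoTree k) → Subset (size T) → Set
Circuit T c = c ≢ ∅ × Even T c × (∀ d → d ⊑ c → Even T d → d ≢ ∅ → d ≡ c)

-- Whenever two vertices lie on a common member, some chain p joining them
-- lies in all members through both; for lex short cycles p is the lex shortest path.
Linked : (T : TwoTree k) → List (Subset (size T)) → Set
Linked T F = ∀ {x y c} → c ∈ F → Touches T c x → Touches T c y →
  ∃ λ p → (∀ z → ∂ (tends T) p z ≡ inc (x , y) z) ×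
          (∀ {d} → d ∈ F → Touches T d x → Touches T d y → p ⊑ d)

-- Injectivity is asked for on the list alone: the contraction below is injective on the families
-- considered, but not on all chains.
unique-map : (f : A → B) {xs : List A} → (∀ {x y} → x ∈ xs → y ∈ xs → f x ≡ f y → x ≡ y) →
             Unique xs → Unique (map f xs)
unique-map f {[]}     inj [] = []
unique-map f {x ∷ xs} inj (x∉ ∷ u) =
  All.map⁺ (All.tabulate λ y∈ eq → All.lookup x∉ y∈ (inj (here refl) (there y∈) eq)) ∷
  unique-map f (λ x∈ y∈ → inj (there x∈) (there y∈)) u

≢true⇒false : ∀ {b} → b ≢ true → b ≡ false
≢true⇒false = 𝔹.¬-not

-- All members containing t coincide, so by uniqueness there is at most one, and a single one would
-- leave t in the sum.
⨁-detects : (F : List (Subset m)) (t : Fin m) → Unique F → lookup (⨁ F) t ≡ false →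
  (∀ {c d} → c ∈ F → d ∈ F → lookup c t ≡ true → lookup d t ≡ true → c ≡ d) →
  All (λ c → lookup c t ≡ false) F
⨁-detects []      t u        sum same = []
⨁-detects (c ∷ F) t (c∉ ∷ u) sum same with lookup c t in eq
... | false = eq ∷ ⨁-detects F t u
  (trans (sym (trans (lookup-⊞ c (⨁ F) t) (cong (_xor lookup (⨁ F) t) eq))) sum)
  (λ c∈ d∈ → same (there c∈) (there d∈))
... | true  = contradiction (trans (sym sum) (trans (lookup-⊞ c (⨁ F) t)
    (cong₂ _xor_ eq (rest F λ d∈ d≡ → All.lookup c∉ d∈ (same (here refl) (there d∈) eq d≡))))) λ ()
  where
  rest : ∀ F → (∀ {d} → d ∈ F → lookup d t ≢ true) → lookup (⨁ F) t ≡ false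
  rest []      _ = lookup-∅ t
  rest (d ∷ F) h = trans (lookup-⊞ d (⨁ F) t) (cong₂ _xor_ (≢true⇒false (h (here refl))) (rest F (h ∘ there)))

-- Removing the last vertex of a 2-tree

module _ {k} (T : TwoTree k) (a b : Fin k) (ab : TTAdj T a b) where
  private
    T⁺ = add T a b ab
    t₀ = proj₁ (edge T ab)

    lookup-at : ∀ c α → lookup (c ⊞ α · ⁅ t₀ ⁆) t₀ ≡ lookup c t₀ xor α
    lookup-at c false = trans (lookup-⊞ c ∅ t₀) (cong (lookup c t₀ xor_) (lookup-∅ t₀))
    lookup-at c true  = trans (lookup-⊞ c ⁅ t₀ ⁆ t₀) (cong (lookup c t₀ xor_) (lookup-⁅⁆ t₀))

    lookup-off : ∀ c α {t} → t ≢ t₀ → lookup (c ⊞ α · ⁅ t₀ ⁆) t ≡ lookup c t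
    lookup-off c false {t} _   = cong (λ ∙ → lookup ∙ t) (⊞-identityʳ c)
    lookup-off c true  {t} t≢t₀ = trans (lookup-⊞ c ⁅ t₀ ⁆ t)
      (trans (cong (lookup c t xor_) (lookup-⁅⁆-≢ t≢t₀)) (𝔹.xor-identityʳ _))

    -- Replaces the path a–v–b through the new vertex v by the edge ab.
    contract : Subset (size T⁺) → Subset (size T)
    contract (α ∷ β ∷ c) = c ⊞ α · ⁅ t₀ ⁆

    contract-⊞ : ∀ c d → contract (c ⊞ d) ≡ contract c ⊞ contract d
    contract-⊞ (α ∷ _ ∷ c) (β ∷ _ ∷ d) =
      trans (cong ((c ⊞ d) ⊞_) (·-⊞ α β ⁅ t₀ ⁆)) (⊞-interchange c d _ _)

    contract-∅ : contract ∅ ≡ ∅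
    contract-∅ = ⊞-identityʳ ∅

    contract-⨁ : ∀ F → ⨁ (map contract F) ≡ contract (⨁ F)
    contract-⨁ []      = sym contract-∅
    contract-⨁ (c ∷ F) = trans (cong (contract c ⊞_) (contract-⨁ F)) (sym (contract-⊞ c (⨁ F)))

    ∂-new : ∀ α β c → ∂ (tends T⁺) (α ∷ β ∷ c) zero ≡ α xor β
    ∂-new α β c = cong₂ _xor_ (𝔹.∧-identityʳ α)
      (trans (cong₂ _xor_ (𝔹.∧-identityʳ β) (∂-shift-zero (tends T) c)) (𝔹.xor-identityʳ β))

    -- At old vertices the path a-v-b has the same boundary as the edge ab.
    ∂-old : ∀ α c x → ∂ (tends T⁺) (α ∷ α ∷ c) (suc x) ≡ ∂ (tends T) (contract (α ∷ α ∷ c)) x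
    ∂-old false c x = trans (∂-shift-suc (tends T) c x) (cong (λ ∙ → ∂ (tends T) ∙ x) (sym (⊞-identityʳ c)))
    ∂-old true  c x = begin
      does (a ≟ x) xor (does (b ≟ x) xor ∂ _ c (suc x))
        ≡⟨ 𝔹.xor-assoc (does (a ≟ x)) _ _ ⟨
      inc (a , b) x xor ∂ _ c (suc x)
        ≡⟨ cong₂ _xor_ (sym (inc-joins (tends T) (proj₂ (edge T ab)) x)) (∂-shift-suc (tends T) c x) ⟩
      inc (tends T t₀) x xor ∂ (tends T) c x
        ≡⟨ cong (_xor ∂ (tends T) c x) (∂-⁅⁆ (tends T) t₀ x) ⟨
      ∂ (tends T) ⁅ t₀ ⁆ x xor ∂ (tends T) c x
        ≡⟨ 𝔹.xor-comm (∂ (tends T) ⁅ t₀ ⁆ x) _ ⟩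
      ∂ (tends T) c x xor ∂ (tends T) ⁅ t₀ ⁆ x
        ≡⟨ ∂-⊞ (tends T) c ⁅ t₀ ⁆ x ⟨
      ∂ (tends T) (c ⊞ ⁅ t₀ ⁆) x ∎
      where open ≡-Reasoning

    -- The shape forced by even degree at v. It covers circuits as well as chains linking two old
    -- vertices, which have no boundary at v.
    data Straight : Subset (size T⁺) → Set where
      straight : ∀ α c → Straight (α ∷ α ∷ c)

    straighten : ∀ c → ∂ (tends T⁺) c zero ≡ false → Straight c
    straighten (α ∷ β ∷ c) eq with refl ← xor-false {α} {β} (trans (sym (∂-new α β c)) eq) = straight α c

    even⁺ : ∀ α c → Even T (contract (α ∷ α ∷ c)) → Even T⁺ (α ∷ α ∷ c)
    even⁺ α c h zero    = trans (∂-new α α c) (𝔹.xor-same α)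
    even⁺ α c h (suc x) = trans (∂-old α c x) (h x)

    even⁻ : ∀ c → Even T⁺ c → Even T (contract c)
    even⁻ c h x with straighten c (h zero)
    ... | straight α c = trans (sym (∂-old α c x)) (h (suc x))

    -- In general contract confuses the edge ab with the path a–v–b.  It is inverted by
    -- avoid on chains that avoid v, and by detour on chains that avoid ab.
    record Section (σ : Subset (size T) → Subset (size T⁺)) : Set where
      field
        σ-∅        : σ ∅ ≡ ∅
        contract-σ : ∀ d → contract (σ d) ≡ d
        σ-even     : ∀ d → Even T d → Even T⁺ (σ d)

    -- `σ-contract` makes contraction injective on the family, `σ-⊑` lifts a competitor inside a
    -- contracted circuit, and `contract-⊑` carries the common chains along.
    record Fits (σ : Subset (size T) → Subset (size T⁺)) (c : Subset (size T⁺)) : Set where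
      field
        σ-contract : σ (contract c) ≡ c
        σ-⊑        : ∀ d → d ⊑ contract c → σ d ⊑ c
        contract-⊑ : ∀ p → p ⊑ c → contract p ⊑ contract c

    avoid : Subset (size T) → Subset (size T⁺)
    avoid d = false ∷ false ∷ d

    avoid-section : Section avoid
    avoid-section = record
      { σ-∅        = refl
      ; contract-σ = ⊞-identityʳ
      ; σ-even     = λ d h → even⁺ false d (subst (Even T) (sym (⊞-identityʳ d)) h)
      }

    avoid-fits : ∀ c → Even T⁺ c → lookup c zero ≡ false → Fits avoid c
    avoid-fits c ev c₀ with straighten c (ev zero)
    avoid-fits _ ev refl | straight _ c = record
      { σ-contract = cong (λ ∙ → false ∷ false ∷ ∙) (⊞-identityʳ c)
      ; σ-⊑        = λ { d d⊑ (suc (suc t)) h → subst (λ ∙ → lookup ∙ t ≡ true) (⊞-identityʳ c) (d⊑ t h) }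
      ; contract-⊑ = λ { (true ∷ _ ∷ p) p⊑ → contradiction (p⊑ zero refl) λ ()
                       ; (false ∷ _ ∷ p) p⊑ t h → subst (λ ∙ → lookup ∙ t ≡ true) (sym (⊞-identityʳ c))
                           (p⊑ (suc (suc t)) (subst (λ ∙ → lookup ∙ t ≡ true) (⊞-identityʳ p) h)) }
      }

    detour : Subset (size T) → Subset (size T⁺)
    detour d = lookup d t₀ ∷ lookup d t₀ ∷ (d ⊞ lookup d t₀ · ⁅ t₀ ⁆)

    ⊞-twice : ∀ c α → c ⊞ α · ⁅ t₀ ⁆ ⊞ α · ⁅ t₀ ⁆ ≡ c
    ⊞-twice c α = trans (⊞-assoc c _ _) (trans (cong (c ⊞_) (⊞-same (α · ⁅ t₀ ⁆))) (⊞-identityʳ c))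

    detour-section : Section detour
    detour-section = record
      { σ-∅        = trans (cong (λ α → α ∷ α ∷ (∅ ⊞ α · ⁅ t₀ ⁆)) (lookup-∅ t₀))
                           (cong (λ ∙ → false ∷ false ∷ ∙) (⊞-identityʳ ∅))
      ; contract-σ = λ d → ⊞-twice d (lookup d t₀)
      ; σ-even     = λ d h → even⁺ (lookup d t₀) (d ⊞ lookup d t₀ · ⁅ t₀ ⁆) (subst (Even T) (sym (⊞-twice d (lookup d t₀))) h)
      }

    detour-fits : ∀ c → Even T⁺ c → lookup c (suc (suc t₀)) ≡ false → Fits detour c
    detour-fits c ev c₀ with straighten c (ev zero)
    ... | straight α c = record
      { σ-contract = trans (cong (λ β → β ∷ β ∷ (c ⊞ α · ⁅ t₀ ⁆ ⊞ β · ⁅ t₀ ⁆)) at)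
                           (cong (λ ∙ → α ∷ α ∷ ∙) (⊞-twice c α))
      ; σ-⊑        = λ { d d⊑ zero       h → trans (sym at) (d⊑ t₀ h)
                       ; d d⊑ (suc zero) h → trans (sym at) (d⊑ t₀ h)
                       ; d d⊑ (suc (suc t)) h → σ-old d d⊑ t h }
      ; contract-⊑ = contract-mono
      }
      where
      at : lookup (c ⊞ α · ⁅ t₀ ⁆) t₀ ≡ α
      -- As c avoids ab, the edge ab in its contraction records precisely whether c passes through
      -- v.
      at = trans (lookup-at c α) (cong (_xor α) c₀)

      σ-old : ∀ d → d ⊑ (c ⊞ α · ⁅ t₀ ⁆) → ∀ t → lookup (d ⊞ lookup d t₀ · ⁅ t₀ ⁆) t ≡ true → lookup c t ≡ true
      σ-old d d⊑ t h with t ≟ t₀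
      ... | yes refl = contradiction (trans (sym h) (trans (lookup-at d _) (𝔹.xor-same (lookup d t₀)))) λ ()
      ... | no  t≢t₀ = trans (sym (lookup-off c α t≢t₀)) (d⊑ t (trans (sym (lookup-off d _ t≢t₀)) h))

      contract-mono : ∀ p → p ⊑ (α ∷ α ∷ c) → contract p ⊑ (c ⊞ α · ⁅ t₀ ⁆)
      contract-mono (β ∷ _ ∷ p) p⊑ t h with t ≟ t₀
      ... | no  t≢t₀ = trans (lookup-off c α t≢t₀) (p⊑ (suc (suc t)) (trans (sym (lookup-off p β t≢t₀)) h))
      ... | yes refl with lookup p t₀ in eq
      ...   | true  = contradiction (trans (sym c₀) (p⊑ (suc (suc t₀)) eq)) λ ()
      ...   | false = trans at (p⊑ zero (trans (sym (trans (lookup-at p β) (cong (_xor β) eq))) h))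

    ab-end : ∀ {x} → proj₁ (tends T t₀) ≡ x ⊎ proj₂ (tends T t₀) ≡ x → a ≡ x ⊎ b ≡ x
    ab-end with tends T t₀ | proj₂ (edge T ab)
    ... | _ | inj₁ refl = id
    ... | _ | inj₂ refl = [ inj₂ , inj₁ ]′

    -- Contraction can add no edge but ab, and adds it only if c passes through v; then the edges of
    -- c at v already reach a and b.
    touches⁻ : ∀ c {x} → Even T⁺ c → Touches T (contract c) x → Touches T⁺ c (suc x)
    touches⁻ c ev (t , ct , tx) with straighten c (ev zero)
    ... | straight α c with t ≟ t₀
    ...   | no  t≢t₀ = suc (suc t) , trans (sym (lookup-off c α t≢t₀)) ct ,
              [ inj₁ ∘ cong suc , inj₂ ∘ cong suc ]′ tx
    ...   | yes refl with lookup c t₀ in eq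
    ...     | true  = suc (suc t₀) , eq , [ inj₁ ∘ cong suc , inj₂ ∘ cong suc ]′ tx
    ...     | false with refl ← trans (sym (trans (lookup-at c α) (cong (_xor α) eq))) ct with ab-end tx
    ...       | inj₁ refl = zero , refl , inj₂ refl
    ...       | inj₂ refl = suc zero , refl , inj₂ refl

    -- When σ inverts the contraction on F, every property of F passes to the contracted family, and
    -- so does the vanishing sum because contraction is linear.
    descend : ∀ {σ F} → Section σ → All (Fits σ) F →
      (∀ G → Unique G → All (Circuit T) G → Linked T G → ⨁ G ≡ ∅ → G ≡ []) →
      Unique F → All (Circuit T⁺) F → Linked T⁺ F → ⨁ F ≡ ∅ → F ≡ []
    descend {σ} {F} sec fits ih uniq circuits linked sum = empty (ih (map contract F)
      (unique-map contract (λ c∈ d∈ eq → trans (sym (σ-contract (fit c∈))) (trans (cong σ eq) (σ-contract (fit d∈)))) uniq)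
      (All.map⁺ (All.tabulate circuit))
      linked′
      (trans (contract-⨁ F) (trans (cong contract sum) contract-∅)))
      where
      open Section sec
      open Fits
      fit = All.lookup fits

      even : ∀ {c} → c ∈ F → Even T⁺ c
      even c∈ = proj₁ (proj₂ (All.lookup circuits c∈))

      empty : ∀ {F} → map contract F ≡ [] → F ≡ []
      empty {[]} _ = refl

      circuit : ∀ {c} → c ∈ F → Circuit T (contract c)
      circuit {c} c∈ with c≢∅ , ev , minimal ← All.lookup circuits c∈ =
        (λ eq → c≢∅ (trans (sym (σ-contract (fit c∈))) (trans (cong σ eq) σ-∅))) ,
        even⁻ c ev ,
        -- A competitor d is lifted by σ, compared with c there, and contracted back.
        λ d d⊑ d-even d≢∅ → trans (sym (contract-σ d)) (cong contract (minimal (σ d) (σ-⊑ (fit c∈) d d⊑) (σ-even d d-even)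
          λ eq → d≢∅ (trans (sym (contract-σ d)) (trans (cong contract eq) contract-∅))))

      linked′ : Linked T (map contract F)
      linked′ {x} {y} c∈′ cx cy with c , c∈ , refl ← ∈-map⁻ contract c∈′
        with p , ∂p , p⊑ ← linked c∈ (touches⁻ c (even c∈) cx) (touches⁻ c (even c∈) cy)
        = contract p , ∂p′ , p⊑′
        where
        ∂p′ : ∀ z → ∂ (tends T) (contract p) z ≡ inc (x , y) z
        ∂p′ z with straighten p (∂p zero)
        ... | straight α p = trans (sym (∂-old α p z)) (∂p (suc z))

        p⊑′ : ∀ {d} → d ∈ map contract F → Touches T d x → Touches T d y → contract p ⊑ d
        p⊑′ d∈′ dx dy with d , d∈ , refl ← ∈-map⁻ contract d∈′ =
          contract-⊑ (fit d∈) p (p⊑ d∈ (touches⁻ d (even d∈) dx) (touches⁻ d (even d∈) dy))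

    both-edges : ∀ c → Even T⁺ c → lookup c zero ≡ true → lookup c (suc zero) ≡ true
    both-edges c ev c₀ with straighten c (ev zero)
    ... | straight α c = c₀

  independent-add :
    (∀ G → Unique G → All (Circuit T) G → Linked T G → ⨁ G ≡ ∅ → G ≡ []) →
    ∀ F → Unique F → All (Circuit T⁺) F → Linked T⁺ F → ⨁ F ≡ ∅ → F ≡ []
  independent-add ih F uniq circuits linked sum with Any.any? (λ c → lookup c zero 𝔹.≟ true) F
  ... | no none = descend avoid-section
    (All.tabulate λ {c} c∈ → avoid-fits c (even c∈) (≢true⇒false (All.lookup (All.¬Any⇒All¬ F none) c∈)))
    ih uniq circuits linked sum
    where
    even : ∀ {c} → c ∈ F → Even T⁺ c
    even c∈ = proj₁ (proj₂ (All.lookup circuits c∈))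
  -- A common chain from a to b is available only when some member meets both, which a member
  -- through v does.
  ... | yes some with c₀ , c₀∈ , c₀v ← find some = by-path (linked c₀∈ (touches-a c₀ c₀v) (touches-b c₀ c₀∈ c₀v))
    where
    even : ∀ {c} → c ∈ F → Even T⁺ c
    even c∈ = proj₁ (proj₂ (All.lookup circuits c∈))

    touches-a : ∀ c → lookup c zero ≡ true → Touches T⁺ c (suc a)
    touches-a c cv = zero , cv , inj₂ refl

    touches-b : ∀ c → c ∈ F → lookup c zero ≡ true → Touches T⁺ c (suc b)
    touches-b c c∈ cv = suc zero , both-edges c (even c∈) cv , inj₂ refl

    touches-ab : ∀ c → lookup c (suc (suc t₀)) ≡ true → Touches T⁺ c (suc a) × Touches T⁺ c (suc b)
    touches-ab c ct with tends T t₀ in eq | proj₂ (edge T ab)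
    ... | _ | inj₁ refl = (suc (suc t₀) , ct , inj₁ (cong (suc ∘ proj₁) eq)) , (suc (suc t₀) , ct , inj₂ (cong (suc ∘ proj₂) eq))
    ... | _ | inj₂ refl = (suc (suc t₀) , ct , inj₂ (cong (suc ∘ proj₂) eq)) , (suc (suc t₀) , ct , inj₁ (cong (suc ∘ proj₁) eq))

    -- By minimality d equals each member through t that contains it, so these members coincide and
    -- cannot cancel at t.
    agree : ∀ d t → d ≢ ∅ → Even T⁺ d → (∀ {c} → c ∈ F → lookup c t ≡ true → d ⊑ c) →
            All (λ c → lookup c t ≡ false) F
    agree d t d≢∅ d-even d⊑ = ⨁-detects F t uniq (trans (cong (λ ∙ → lookup ∙ t) sum) (lookup-∅ t))
      λ c∈ c′∈ ct c′t → trans (sym (is-d c∈ ct)) (is-d c′∈ c′t)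
      where
      is-d : ∀ {c} → c ∈ F → lookup c t ≡ true → d ≡ c
      is-d c∈ ct = proj₂ (proj₂ (All.lookup circuits c∈)) d (d⊑ c∈ ct) d-even d≢∅

    by-path : (∃ λ p → (∀ z → ∂ (tends T⁺) p z ≡ inc (suc a , suc b) z) ×
                       (∀ {d} → d ∈ F → Touches T⁺ d (suc a) → Touches T⁺ d (suc b) → p ⊑ d)) → F ≡ []
    by-path (p , ∂p , p⊑) with straighten p (∂p zero)
    -- Closing p by a-v-b gives an even chain inside every member through v. Hence no member passes
    -- through v, against the choice of `c₀`.
    ... | straight false p = contradiction (trans (sym (All.lookup (agree (true ∷ true ∷ p) zero (λ ())
            (even⁺ true p λ x → begin
              ∂ (tends T) (p ⊞ ⁅ t₀ ⁆) x                   ≡⟨ ∂-⊞ (tends T) p ⁅ t₀ ⁆ x ⟩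
              ∂ (tends T) p x xor ∂ (tends T) ⁅ t₀ ⁆ x     ≡⟨ cong₂ _xor_ (∂-shift-suc (tends T) p x) (sym (∂-⁅⁆ (tends T) t₀ x)) ⟨
              ∂ (tends T⁺) (false ∷ false ∷ p) (suc x) xor inc (tends T t₀) x
                                                           ≡⟨ cong₂ _xor_ (∂p (suc x)) (inc-joins (tends T) (proj₂ (edge T ab)) x) ⟩
              inc (a , b) x xor inc (a , b) x              ≡⟨ 𝔹.xor-same (inc (a , b) x) ⟩
              false                                        ∎)
            λ { {c} c∈ cv zero          _ → cv
              ; {c} c∈ cv (suc zero)    _ → both-edges c (even c∈) cv
              ; {c} c∈ cv (suc (suc t)) h → p⊑ c∈ (touches-a c cv) (touches-b c c∈ cv) (suc (suc t)) h }) c₀∈)) c₀v) λ ()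
      where open ≡-Reasoning
    -- Since p contains both edges at v, a member containing ab contains the whole triangle. Hence
    -- no member contains ab and `detour` inverts the contraction.
    ... | straight true p = descend detour-section
      (All.tabulate λ {c} c∈ → detour-fits c (even c∈) (All.lookup no-ab c∈)) ih uniq circuits linked sum
      where
      triangle-even : Even T⁺ (true ∷ true ∷ ⁅ t₀ ⁆)
      triangle-even = even⁺ true ⁅ t₀ ⁆ λ x →
        trans (cong (λ ∙ → ∂ (tends T) ∙ x) (⊞-same ⁅ t₀ ⁆)) (∂-∅ (tends T) x)

      p⊑′ : ∀ c → c ∈ F → lookup c (suc (suc t₀)) ≡ true → (true ∷ true ∷ p) ⊑ c
      p⊑′ c c∈ ct = p⊑ c∈ (proj₁ (touches-ab c ct)) (proj₂ (touches-ab c ct))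

      no-ab : All (λ c → lookup c (suc (suc t₀)) ≡ false) F
      no-ab = agree (true ∷ true ∷ ⁅ t₀ ⁆) (suc (suc t₀)) (λ ()) triangle-even
        λ { {c} c∈ ct zero       _ → p⊑′ c c∈ ct zero refl
          ; {c} c∈ ct (suc zero) _ → p⊑′ c c∈ ct (suc zero) refl
          ; {c} c∈ ct (suc (suc t)) h → subst (λ ∙ → lookup c (suc (suc ∙)) ≡ true) (sym (lookup-⁅⁆⇒≡ t₀ h)) ct }

-- A single circuit exists here, the full triangle, so looking at one edge suffices.
independent-K₃ : ∀ F → Unique F → All (Circuit K₃) F → ⨁ F ≡ ∅ → F ≡ []
independent-K₃ F uniq circuits sum = empty F (⨁-detects F zero uniq (cong (λ ∙ → lookup ∙ zero) sum)
    λ c∈ d∈ _ _ → trans (full (All.lookup circuits c∈)) (sym (full (All.lookup circuits d∈)))) circuits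
  where
  full : ∀ {c} → Circuit K₃ c → c ≡ true ∷ true ∷ true ∷ []
  full {true  ∷ true  ∷ true  ∷ []} _              = refl
  full {false ∷ false ∷ false ∷ []} (c≢∅ , _)      = contradiction refl c≢∅
  full {true  ∷ true  ∷ false ∷ []} (_ , even , _) = contradiction (even zero) λ ()
  full {true  ∷ false ∷ true  ∷ []} (_ , even , _) = contradiction (even (suc (suc zero))) λ ()
  full {true  ∷ false ∷ false ∷ []} (_ , even , _) = contradiction (even (suc zero)) λ ()
  full {false ∷ true  ∷ true  ∷ []} (_ , even , _) = contradiction (even (suc (suc zero))) λ ()
  full {false ∷ true  ∷ false ∷ []} (_ , even , _) = contradiction (even zero) λ ()
  full {false ∷ false ∷ true  ∷ []} (_ , even , _) = contradiction (even zero) λ ()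

  empty : ∀ F → All (λ c → lookup c zero ≡ false) F → All (Circuit K₃) F → F ≡ []
  empty []      _         _           = refl
  empty (c ∷ F) (c₀ ∷ _) (circ ∷ _) = contradiction (trans (sym c₀) (cong (λ ∙ → lookup ∙ zero) (full circ))) λ ()

independent : (T : TwoTree k) → ∀ F → Unique F → All (Circuit T) F → Linked T F → ⨁ F ≡ ∅ → F ≡ []
independent K₃             F uniq circuits linked = independent-K₃ F uniq circuits
independent (add T a b ab) = independent-add T a b ab (independent T)

-- Walks and shortest walks

weight : (Fin m → ℕ) → List (Fin m) → ℕ
weight f es = sum (map f es)

weight-++ : (f : Fin m → ℕ) (xs ys : List (Fin m)) → weight f (xs ++ ys) ≡ weight f xs + weight f ys
weight-++ f xs ys = trans (cong sum (map-++ f xs ys)) (sum-++ (map f xs) (map f ys))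

weight-↭ : (f : Fin m → ℕ) {xs ys : List (Fin m)} → xs ↭ ys → weight f xs ≡ weight f ys
weight-↭ f = sum-↭ ∘ ↭.map⁺ f

weight-↭-++ : (f : Fin m → ℕ) {xs : List (Fin m)} (ys zs : List (Fin m)) → xs ↭ ys ++ zs → weight f xs ≡ weight f ys + weight f zs
weight-↭-++ f ys zs p = trans (weight-↭ f p) (weight-++ f ys zs)

weight-cancel : (f : Fin m → ℕ) {xs : List (Fin m)} (ys zs : List (Fin m)) → xs ↭ ys ++ zs → weight f zs ≤ weight f xs
weight-cancel f ys zs p = subst (_ ≤_) (sym (weight-↭-++ f ys zs p)) (ℕ.m≤n+m _ (weight f ys))

module Walks {n m : ℕ} (ends : Fin m → Fin n × Fin n) where
  private variable
    u v x y : Fin n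

  V : Walk ends u v → List (Fin n)
  V = verts ends

  E : Walk ends u v → List (Fin m)
  E = edgesW ends

  infixr 5 _◅◅_
  _◅◅_ : Walk ends u v → Walk ends v x → Walk ends u x
  []         ◅◅ Q = Q
  cons e j P ◅◅ Q = cons e j (P ◅◅ Q)

  E-◅◅ : (P : Walk ends u v) (Q : Walk ends v x) → E (P ◅◅ Q) ≡ E P ++ E Q
  E-◅◅ []           Q = refl
  E-◅◅ (cons e _ P) Q = cong (e ∷_) (E-◅◅ P Q)

  reverse : Walk ends u v → Walk ends v u
  reverse []           = []
  reverse (cons e j P) = reverse P ◅◅ cons e (Sum.swap j) []

  E-reverse : (P : Walk ends u v) → E (reverse P) ↭ E P
  E-reverse []           = ↭-refl
  E-reverse (cons e j P) = ↭-trans (↭-reflexive (E-◅◅ (reverse P) _))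
    (↭-trans (↭.++-comm (E (reverse P)) (e ∷ [])) (↭.prep e (E-reverse P)))

  start∈V : (P : Walk ends u v) → u ∈ V P
  start∈V []           = here refl
  start∈V (cons _ _ _) = here refl

  length-V : (P : Walk ends u v) → length (V P) ≡ suc (length (E P))
  length-V []           = refl
  length-V (cons _ _ P) = cong suc (length-V P)

  splitAt : (P : Walk ends u v) → x ∈ V P →
    Σ (Walk ends u x) λ Q → Σ (Walk ends x v) λ R → E P ≡ E Q ++ E R
  splitAt []           (here refl) = [] , [] , refl
  splitAt (cons e j P) (here refl) = [] , cons e j P , refl
  splitAt (cons e j P) (there x∈)  with Q , R , eq ← splitAt P x∈ = cons e j Q , R , cong (e ∷_) eq

  joins-ends : ∀ {e} → Joins ends e u v → (proj₁ (ends e) ≡ x) ⊎ (proj₂ (ends e) ≡ x) → x ≡ u ⊎ x ≡ v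
  joins-ends (inj₁ eq) = [ (λ h → inj₁ (trans (sym h) (cong proj₁ eq))) , (λ h → inj₂ (trans (sym h) (cong proj₂ eq))) ]′
  joins-ends (inj₂ eq) = [ (λ h → inj₂ (trans (sym h) (cong proj₁ eq))) , (λ h → inj₁ (trans (sym h) (cong proj₂ eq))) ]′

  joins-start : ∀ {e} → Joins ends e u v → (proj₁ (ends e) ≡ u) ⊎ (proj₂ (ends e) ≡ u)
  joins-start (inj₁ eq) = inj₁ (cong proj₁ eq)
  joins-start (inj₂ eq) = inj₂ (cong proj₂ eq)

  ends∈V : ∀ {e} (P : Walk ends u v) → e ∈ E P → (proj₁ (ends e) ≡ x) ⊎ (proj₂ (ends e) ≡ x) → x ∈ V P
  ends∈V (cons e j P) (here refl) h with joins-ends j h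
  ... | inj₁ refl = here refl
  ... | inj₂ refl = there (start∈V P)
  ends∈V (cons e j P) (there e∈)  h = there (ends∈V P e∈ h)

  path⇒unique-E : (P : Walk ends u v) → IsPath ends P → Unique (E P)
  path⇒unique-E []           _         = []
  path⇒unique-E (cons e j P) (u∉ ∷ pP) =
    All.tabulate (λ e′∈ eq → All.lookup u∉ (ends∈V P (subst (_∈ E P) (sym eq) e′∈) (joins-start j)) refl) ∷ path⇒unique-E P pP

  end∈V : (P : Walk ends u v) → v ∈ V P
  end∈V []           = here refl
  end∈V (cons _ _ P) = there (end∈V P)

  -- A path from x uses an edge at x only in its first step, and taking e first would reach the
  -- final vertex u after one step, while P has at least two.
  closed-unique-E : (P : Walk ends x u) {e : Fin m} → IsPath ends P → 2 ≤ length (E P) → Joins ends e u x → Unique (e ∷ E P)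
  closed-unique-E (cons _ _ []) _ (s≤s ()) _
  closed-unique-E {x} {u} (cons e₁ j₁ P@(cons e₂ j₂ Q)) {e} pP@(x∉ ∷ y∉ ∷ _) _ j = All.tabulate fresh ∷ path⇒unique-E (cons e₁ j₁ P) pP
    where
    fresh : ∀ {e′} → e′ ∈ e₁ ∷ E P → e ≢ e′
    fresh (there e∈)  refl = All.lookup x∉ (ends∈V P e∈ (joins-start (Sum.swap j))) refl
    fresh (here refl) refl with joins-ends j₁ (joins-start j)
    ... | inj₁ refl = All.lookup x∉ (end∈V P) refl
    ... | inj₂ refl = All.lookup y∉ (end∈V Q) refl

  -- Edge lists are tracked up to permutation only, which is all that weights and `mod2` can see.
  findLoop : (P : Walk ends u v) → IsPath ends P ⊎
    ∃ λ y → Σ (Walk ends y y) λ B → Σ (Walk ends u v) λ Q → 0 < length (E B) × E P ↭ E B ++ E Q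
  findLoop []               = inj₁ ([] ∷ [])
  findLoop {u} (cons e j P) with findLoop P
  ... | inj₂ (y , B , Q , 0< , p) =
    inj₂ (y , B , cons e j Q , 0< , ↭-trans (↭.prep e p) (↭-sym (↭.shift e (E B) (E Q))))
  ... | inj₁ pP with _∈?_ _≟_ u (V P)
  ...   | no  u∉ = inj₁ (All.tabulate (λ x∈ eq → u∉ (subst (_∈ V P) (sym eq) x∈)) ∷ pP)
  ...   | yes u∈ with A , Q , eq ← splitAt P u∈ =
    inj₂ (u , cons e j A , Q , s≤s z≤n , ↭-reflexive (cong (e ∷_) eq))

  pathify : (P : Walk ends u v) → Σ (Walk ends u v) λ Q → IsPath ends Q × (∀ f → weight f (E Q) ≤ weight f (E P))
  pathify P = go (length (E P)) P ℕ.≤-refl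
    where
    go : ∀ k (P : Walk ends u v) → length (E P) ≤ k →
         Σ (Walk ends u v) λ Q → IsPath ends Q × (∀ f → weight f (E Q) ≤ weight f (E P))
    go zero    []  _   = [] , [] ∷ [] , λ f → z≤n
    go (suc k) P   P≤k with findLoop P
    ... | inj₁ pP = P , pP , λ f → ℕ.≤-refl
    ... | inj₂ (_ , B , Q , 0<B , p)
      with R , pR , R≤ ← go k Q (ℕ.≤-pred (ℕ.≤-trans (ℕ.+-monoˡ-≤ (length (E Q)) 0<B)
             (ℕ.≤-trans (ℕ.≤-reflexive (sym (trans (↭.↭-length p) (length-++ (E B))))) P≤k)))
      = R , pR , λ f → ℕ.≤-trans (R≤ f) (weight-cancel f (E B) (E Q) p)

  V-start : (P : Walk ends x v) (Q : Walk ends y v) → V P ≡ V Q → x ≡ y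
  V-start []           []           eq = proj₁ (∷-injective eq)
  V-start []           (cons _ _ _) eq = proj₁ (∷-injective eq)
  V-start (cons _ _ _) []           eq = proj₁ (∷-injective eq)
  V-start (cons _ _ _) (cons _ _ _) eq = proj₁ (∷-injective eq)

  -- `IsLSP` tells walks apart by their vertices whereas `LexShort` asks for edges; simplicity
  -- connects the two.
  V-determines-E : Simple ends → (P Q : Walk ends u v) → V P ≡ V Q → E P ≡ E Q
  V-determines-E simple []              []              _  = refl
  V-determines-E simple []              (cons _ _ [])   ()
  V-determines-E simple []              (cons _ _ (cons _ _ _)) ()
  V-determines-E simple (cons _ _ [])   []              ()
  V-determines-E simple (cons _ _ (cons _ _ _)) []      ()
  V-determines-E simple (cons e j P) (cons e′ j′ Q) eq with refl ← V-start P Q (proj₂ (∷-injective eq)) =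
    cong₂ _∷_ (proj₂ simple e e′ _ _ j j′) (V-determines-E simple P Q (proj₂ (∷-injective eq)))

  module Shortest (κ : Fin m → ℕ) (κ>0 : ∀ e → 0 < κ e) where

    -- The bound s on the number of edges makes the search finite. As every edge has κ at least one,
    -- taking s = K excludes no walk of κ-weight at most K.
    Near : ℕ → ℕ → Fin n → Fin n → Set
    Near s K u v = Σ (Walk ends u v) λ P → length (E P) ≤ s × weight κ (E P) ≤ K

    near? : ∀ s K u v → Dec (Near s K u v)
    near? s K u v with u ≟ v
    near? s K u v | yes refl = yes ([] , z≤n , z≤n)
    near? zero K u v | no u≢v = no λ { ([] , _) → u≢v refl }
    near? (suc s) K u v | no u≢v = map′ to from (Fin.any? λ e → (κ e ≤? K) ×-dec
      (((u ≟ proj₁ (ends e)) ×-dec near? s (K ∸ κ e) (proj₂ (ends e)) v) ⊎-dec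
       ((u ≟ proj₂ (ends e)) ×-dec near? s (K ∸ κ e) (proj₁ (ends e)) v)))
      where
      to : _ → Near (suc s) K u v
      to (e , κe≤K , inj₁ (refl , P , ℓ , w)) = cons e (inj₁ refl) P , s≤s ℓ ,
        ℕ.≤-trans (ℕ.+-monoʳ-≤ (κ e) w) (ℕ.≤-reflexive (ℕ.m+[n∸m]≡n κe≤K))
      to (e , κe≤K , inj₂ (refl , P , ℓ , w)) = cons e (inj₂ refl) P , s≤s ℓ ,
        ℕ.≤-trans (ℕ.+-monoʳ-≤ (κ e) w) (ℕ.≤-reflexive (ℕ.m+[n∸m]≡n κe≤K))

      tail≤ : ∀ {a b} → a + b ≤ K → b ≤ K ∸ a
      tail≤ {a} {b} h = subst (_≤ K ∸ a) (ℕ.m+n∸m≡n a b) (ℕ.∸-monoˡ-≤ a h)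

      from : Near (suc s) K u v → _
      from ([] , _) = contradiction refl u≢v
      from (cons e (inj₁ eq) P , s≤s ℓ , w) = e , ℕ.≤-trans (ℕ.m≤m+n _ _) w ,
        inj₁ (sym (cong proj₁ eq) , subst (λ ∙ → Near s (K ∸ κ e) (proj₂ ∙) v) (sym eq) (P , ℓ , tail≤ w))
      from (cons e (inj₂ eq) P , s≤s ℓ , w) = e , ℕ.≤-trans (ℕ.m≤m+n _ _) w ,
        inj₂ (sym (cong proj₂ eq) , subst (λ ∙ → Near s (K ∸ κ e) (proj₁ ∙) v) (sym eq) (P , ℓ , tail≤ w))

    length≤weight : ∀ es → length es ≤ weight κ es
    length≤weight []       = z≤n
    length≤weight (e ∷ es) = ℕ.+-mono-≤ (κ>0 e) (length≤weight es)

    Minimal : Walk ends u v → Set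
    Minimal {u} {v} P = ∀ (Q : Walk ends u v) → weight κ (E P) ≤ weight κ (E Q)

    minimise : (P : Walk ends u v) → ∃ Minimal
    minimise P = go _ P ℕ.≤-refl
      where
      go : ∀ K (P : Walk ends u v) → weight κ (E P) ≤ K → Σ (Walk ends u v) Minimal
      go zero    P P≤ = P , λ Q → ℕ.≤-trans P≤ z≤n
      go (suc K) P P≤ with near? K K _ _
      ... | yes (Q , _ , Q≤) = go K Q Q≤
      ... | no  none = P , λ Q → ℕ.≤-trans P≤ (ℕ.≰⇒> λ Q≤ → none (Q , ℕ.≤-trans (length≤weight (E Q)) Q≤ , Q≤))

    minimal⇒path : (P : Walk ends u v) → Minimal P → IsPath ends P
    minimal⇒path P min with findLoop P
    ... | inj₁ pP = pP
    ... | inj₂ (_ , B , Q , 0<B , p) = contradiction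
      (ℕ.≤-trans (ℕ.+-monoˡ-≤ (weight κ (E Q)) (ℕ.≤-trans 0<B (length≤weight (E B))))
        (ℕ.≤-trans (ℕ.≤-reflexive (sym (weight-↭-++ κ (E B) (E Q) p))) (min Q)))
      (ℕ.<-irrefl refl)

    minimal-tail : ∀ {e} (j : Joins ends e u x) (P : Walk ends x v) → Minimal (cons e j P) → Minimal P
    minimal-tail {e = e} j P min Q = ℕ.+-cancelˡ-≤ (κ e) _ _ (min (cons e j Q))

    -- If two minimal paths on the same vertices diverge after u, to x and y, then each of
    -- them later visits the second vertex of the other, and both κ(ux) < κ(uy) < κ(ux).
    minimal-unique : (P Q : Walk ends u v) → IsPath ends P → IsPath ends Q → Minimal P → Minimal Q →
      (∀ z → z ∈ V P → z ∈ V Q) → (∀ z → z ∈ V Q → z ∈ V P) → V P ≡ V Q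
    minimal-unique []           []           _ _ _ _ _ _ = refl
    minimal-unique []           (cons e _ Q) _ _ _ min _ _ =
      contradiction (ℕ.≤-trans (ℕ.m≤m+n (κ e) _) (min [])) (ℕ.<⇒≱ (κ>0 e))
    minimal-unique (cons e _ P) []           _ _ min _ _ _ =
      contradiction (ℕ.≤-trans (ℕ.m≤m+n (κ e) _) (min [])) (ℕ.<⇒≱ (κ>0 e))
    minimal-unique {u} {v} (cons {x = x} e j P) (cons {x = y} e′ j′ Q) (u∉P ∷ pP) (u∉Q ∷ pQ) minP minQ P⊆Q Q⊆P with x ≟ y
    ... | yes refl = cong (u ∷_) (minimal-unique P Q pP pQ (minimal-tail j P minP) (minimal-tail j′ Q minQ)
            (λ z z∈ → tail∈ u∉P z∈ (P⊆Q z (there z∈))) (λ z z∈ → tail∈ u∉Q z∈ (Q⊆P z (there z∈))))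
      where
      tail∈ : ∀ {z xs ys} → All (u ≢_) xs → z ∈ xs → z ∈ u ∷ ys → z ∈ ys
      tail∈ u∉ z∈ (here refl) = contradiction refl (All.lookup u∉ z∈)
      tail∈ u∉ z∈ (there z∈′) = z∈′
    ... | no x≢y = contradiction (first< e e′ j j′ P Q u∉Q x≢y minP Q⊆P)
                     (ℕ.<⇒≯ (first< e′ e j′ j Q P u∉P (x≢y ∘ sym) minQ P⊆Q))
      where
      first< : ∀ {x y} e e′ (j : Joins ends e u x) (j′ : Joins ends e′ u y) (P : Walk ends x v) (Q : Walk ends y v) →
        All (u ≢_) (V Q) → x ≢ y → Minimal (cons e j P) →
        (∀ z → z ∈ u ∷ V Q → z ∈ u ∷ V P) → κ e < κ e′
      first< {x} {y} e e′ j j′ P Q u∉Q x≢y min sub with sub y (there (start∈V Q))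
      ... | here refl = contradiction refl (All.lookup u∉Q (start∈V Q))
      ... | there y∈ with splitAt P y∈
      ...   | [] , _ = contradiction refl x≢y
      ...   | A@(cons a _ _) , B , eq = ℕ.+-cancelʳ-< (weight κ (E B)) (κ e) (κ e′) (begin-strict
              κ e + weight κ (E B)                    <⟨ ℕ.+-monoʳ-< (κ e) (ℕ.m<n+m _ (ℕ.≤-trans (κ>0 a) (ℕ.m≤m+n _ _))) ⟩
              κ e + (weight κ (E A) + weight κ (E B)) ≡⟨ cong (κ e +_) (trans (cong (weight κ) eq) (weight-++ κ (E A) (E B))) ⟨
              κ e + weight κ (E P)                    ≤⟨ min (cons e′ j′ B) ⟩
              κ e′ + weight κ (E B)                   ∎)
        where open ℕ.≤-Reasoning

-- Lex shortest paths

module _ {_≺_ : Fin n → Fin n → Set} (sto : IsStrictTotalOrder _≡_ _≺_) where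
  private module ≺ = IsStrictTotalOrder sto

  insert : ∀ x s → AllPairs _≺_ s →
    ∃ λ s′ → AllPairs _≺_ s′ × (∀ {y} → y ∈ s′ → y ≡ x ⊎ y ∈ s) × x ∈ s′ × (∀ {y} → y ∈ s → y ∈ s′)
  insert x []      []         = x ∷ [] , [] ∷ [] , (λ { (here eq) → inj₁ eq }) , here refl , λ ()
  insert x (y ∷ s) (y≺ ∷ ≺s) with ≺.compare x y
  ... | tri< x≺y _ _ = x ∷ y ∷ s , (x≺y ∷ All.map (≺.trans x≺y) y≺) ∷ y≺ ∷ ≺s ,
        (λ { (here eq) → inj₁ eq ; (there y∈) → inj₂ y∈ }) , here refl , there
  ... | tri≈ _ refl _ = y ∷ s , y≺ ∷ ≺s , inj₂ , here refl , id
  ... | tri> _ _ y≺x with s′ , ≺s′ , from , x∈ , to ← insert x s ≺s =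
        y ∷ s′ , All.tabulate (λ z∈ → [ (λ { refl → y≺x }) , All.lookup y≺ ]′ (from z∈)) ∷ ≺s′ ,
        (λ { (here eq) → inj₂ (here eq) ; (there z∈) → Sum.map₂ there (from z∈) }) ,
        there x∈ , λ { (here eq) → here eq ; (there z∈) → there (to z∈) }

  sort : ∀ xs → ∃ λ s → AllPairs _≺_ s × (∀ {y} → y ∈ xs → y ∈ s)
  sort []       = [] , [] , λ ()
  sort (x ∷ xs) with s , ≺s , to ← sort xs with s′ , ≺s′ , _ , x∈ , to′ ← insert x s ≺s =
    s′ , ≺s′ , λ { (here refl) → x∈ ; (there y∈) → to′ (to y∈) }

-- The powers of two make the total of a set of vertices depend foremost on the first
-- vertices of s that it contains.
value : List (Fin n) → Fin n → ℕ
value []      v = 0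
value (x ∷ s) v = (if does (x ≟ v) then 2 ^ length s else 0) + value s v

total : List (Fin n) → List (Fin n) → ℕ
total s X = sum (map (value s) X)

total-[] : (X : List (Fin n)) → total [] X ≡ 0
total-[] []      = refl
total-[] (_ ∷ X) = total-[] X

total-∉ : ∀ (x : Fin n) s {X} → x ∉ X → total (x ∷ s) X ≡ total s X
total-∉ x s {[]}    _  = refl
total-∉ x s {v ∷ X} x∉ with x ≟ v
... | yes refl = contradiction (here refl) x∉
... | no  _    = cong (value s v +_) (total-∉ x s (x∉ ∘ there))

total-∈ : ∀ (x : Fin n) s {X} → Unique X → x ∈ X → total (x ∷ s) X ≡ 2 ^ length s + total s X
total-∈ x s {v ∷ X} (v∉ ∷ u) x∈ with x ≟ v
... | yes refl = trans (cong (2 ^ length s + value s v +_) (total-∉ x s λ x∈ → All.lookup v∉ x∈ refl))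
                       (ℕ.+-assoc (2 ^ length s) _ _)
... | no x≢v with x∈
...   | here x≡v  = contradiction x≡v x≢v
...   | there x∈X = trans (cong (value s v +_) (total-∈ x s u x∈X))
          (solve 3 (λ a b c → a :+ (b :+ c) := b :+ (a :+ c)) refl (value s v) (2 ^ length s) (total s X))
  where open +-*-Solver

-- A binary expansion: a list without repetitions contributes each power of two at most once.
total< : ∀ s {X : List (Fin n)} → Unique X → total s X < 2 ^ length s
total< []      {X} u = s≤s (ℕ.≤-reflexive (total-[] X))
total< (x ∷ s) {X} u with _∈?_ _≟_ x X
... | yes x∈ = begin-strict
  total (x ∷ s) X                    ≡⟨ total-∈ x s u x∈ ⟩
  2 ^ length s + total s X           <⟨ ℕ.+-monoʳ-< (2 ^ length s) (total< s u) ⟩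
  2 ^ length s + 2 ^ length s        ≡⟨ cong (2 ^ length s +_) (ℕ.+-identityʳ _) ⟨
  2 ^ length s + (2 ^ length s + 0)  ∎
  where open ℕ.≤-Reasoning
... | no  x∉ = begin-strict
  total (x ∷ s) X                    ≡⟨ total-∉ x s x∉ ⟩
  total s X                          <⟨ total< s u ⟩
  2 ^ length s                       ≤⟨ ℕ.m≤m+n _ _ ⟩
  2 ^ length s + (2 ^ length s + 0)  ∎
  where open ℕ.≤-Reasoning

module _ (_≺_ : Fin n → Fin n → Set) where
  Wins : List (Fin n) → List (Fin n) → List (Fin n) → Set
  Wins s X Y = total s Y < total s X × ∃ λ x → x ∈ X × x ∉ Y × (∀ {y} → y ∈ s → y ∈ Y → y ∉ X → x ≺ y)

  Same : List (Fin n) → List (Fin n) → List (Fin n) → Set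
  Same s X Y = total s X ≡ total s Y × (∀ {v} → v ∈ s → (v ∈ X → v ∈ Y) × (v ∈ Y → v ∈ X))

  -- The first vertex of s on which X and Y differ decides the numerical and the lexicographic
  -- comparison alike.
  compareSets : ∀ s → AllPairs _≺_ s → ∀ {X Y} → Unique X → Unique Y → Same s X Y ⊎ Wins s X Y ⊎ Wins s Y X
  compareSets [] _ {X} {Y} uX uY = inj₁ (trans (total-[] X) (sym (total-[] Y)) , λ ())
  compareSets (x ∷ s) (x≺ ∷ ≺s) {X} {Y} uX uY with _∈?_ _≟_ x X | _∈?_ _≟_ x Y | compareSets s ≺s uX uY
  ... | yes x∈X | no x∉Y | _ = inj₂ (inj₁ (beats , x , x∈X , x∉Y , λ
        { (here refl) _ y∉X → contradiction x∈X y∉X ; (there y∈) _ _ → All.lookup x≺ y∈ }))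
    where
    open ℕ.≤-Reasoning
    beats : total (x ∷ s) Y < total (x ∷ s) X
    beats = begin-strict
      total (x ∷ s) Y          ≡⟨ total-∉ x s x∉Y ⟩
      total s Y                <⟨ total< s uY ⟩
      2 ^ length s             ≤⟨ ℕ.m≤m+n _ _ ⟩
      2 ^ length s + total s X ≡⟨ total-∈ x s uX x∈X ⟨
      total (x ∷ s) X          ∎
  ... | no x∉X | yes x∈Y | _ = inj₂ (inj₂ (beats , x , x∈Y , x∉X , λ
        { (here refl) _ y∉Y → contradiction x∈Y y∉Y ; (there y∈) _ _ → All.lookup x≺ y∈ }))
    where
    open ℕ.≤-Reasoning
    beats : total (x ∷ s) X < total (x ∷ s) Y
    beats = begin-strict
      total (x ∷ s) X          ≡⟨ total-∉ x s x∉X ⟩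
      total s X                <⟨ total< s uX ⟩
      2 ^ length s             ≤⟨ ℕ.m≤m+n _ _ ⟩
      2 ^ length s + total s Y ≡⟨ total-∈ x s uY x∈Y ⟨
      total (x ∷ s) Y          ∎
  ... | yes x∈X | yes x∈Y | rec rewrite total-∈ x s uX x∈X | total-∈ x s uY x∈Y = go rec
    where
    go : _ → _
    go (inj₁ (eq , same)) = inj₁ (cong (2 ^ length s +_) eq , λ
      { (here refl) → (λ _ → x∈Y) , (λ _ → x∈X) ; (there v∈) → same v∈ })
    go (inj₂ (inj₁ (lt , z , z∈ , z∉ , first))) = inj₂ (inj₁ (ℕ.+-monoʳ-< (2 ^ length s) lt , z , z∈ , z∉ , λ
      { (here refl) _ y∉ → contradiction x∈X y∉ ; (there v∈) → first v∈ }))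
    go (inj₂ (inj₂ (lt , z , z∈ , z∉ , first))) = inj₂ (inj₂ (ℕ.+-monoʳ-< (2 ^ length s) lt , z , z∈ , z∉ , λ
      { (here refl) _ y∉ → contradiction x∈Y y∉ ; (there v∈) → first v∈ }))
  ... | no x∉X | no x∉Y | rec rewrite total-∉ x s x∉X | total-∉ x s x∉Y = go rec
    where
    go : _ → _
    go (inj₁ (eq , same)) = inj₁ (eq , λ
      { (here refl) → (λ x∈ → contradiction x∈ x∉X) , (λ x∈ → contradiction x∈ x∉Y) ; (there v∈) → same v∈ })
    go (inj₂ (inj₁ (lt , z , z∈ , z∉ , first))) = inj₂ (inj₁ (lt , z , z∈ , z∉ , λ
      { (here refl) y∈ _ → contradiction y∈ x∉Y ; (there v∈) → first v∈ }))
    go (inj₂ (inj₂ (lt , z , z∈ , z∉ , first))) = inj₂ (inj₂ (lt , z , z∈ , z∉ , λ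
      { (here refl) y∈ _ → contradiction y∈ x∉X ; (there v∈) → first v∈ }))

-- Comparison in base B with low digits from 1 to B rather than from 0 to B - 1, the range in which
-- the penalty of a path falls.
digits : ∀ B a x a′ x′ → 0 < x → x′ ≤ B → B * a + x ≤ B * a′ + x′ → a < a′ ⊎ (a ≡ a′ × x ≤ x′)
digits B a x a′ x′ 0<x x′≤B h with ℕ.<-cmp a a′
... | tri< a<a′ _ _ = inj₁ a<a′
... | tri≈ _ refl _ = inj₂ (refl , ℕ.+-cancelˡ-≤ (B * a) _ _ h)
... | tri> _ _ a′<a = contradiction h (ℕ.<⇒≱ (begin-strict
  B * a′ + x′     ≤⟨ ℕ.+-monoʳ-≤ (B * a′) x′≤B ⟩
  B * a′ + B      ≡⟨ ℕ.+-comm (B * a′) B ⟩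
  B + B * a′      ≡⟨ ℕ.*-suc B a′ ⟨
  B * suc a′      ≤⟨ ℕ.*-monoʳ-≤ B a′<a ⟩
  B * a           <⟨ ℕ.m<m+n (B * a) 0<x ⟩
  B * a + x       ∎))
  where open ℕ.≤-Reasoning

unique⇒length≤ : {X : List (Fin n)} → Unique X → length X ≤ n
unique⇒length≤ {X = X} u = Fin.injective⇒≤ (λ {i} {j} → inj X u i j)
  where
  inj : ∀ X → Unique X → ∀ i j → List.lookup X i ≡ List.lookup X j → i ≡ j
  inj (x ∷ X) (x∉ ∷ u) zero    zero    eq = refl
  inj (x ∷ X) (x∉ ∷ u) zero    (suc j) eq = contradiction eq (All.lookup x∉ (∈-lookup j))
  inj (x ∷ X) (x∉ ∷ u) (suc i) zero    eq = contradiction (sym eq) (All.lookup x∉ (∈-lookup i))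
  inj (x ∷ X) (x∉ ∷ u) (suc i) (suc j) eq = cong suc (inj X u i j eq)

module LexShortest {n m : ℕ} (ends : Fin m → Fin n × Fin n) (w : Fin m → ℕ)
  (_≺_ : Fin n → Fin n → Set) (sto : IsStrictTotalOrder _≡_ _≺_)
  (simple : Simple ends) (connected : Connected ends) where

  open Walks ends
  private
    module ≺ = IsStrictTotalOrder sto

    s = proj₁ (sort sto (allFin n))
    ≺s = proj₁ (proj₂ (sort sto (allFin n)))

    all∈s : ∀ v → v ∈ s
    all∈s v = proj₂ (proj₂ (sort sto (allFin n))) (∈-allFin v)

    M = 2 ^ length s

    -- Complementing the value turns a preference for large totals into one for small penalties, and
    -- keeps every penalty positive.
    pen : Fin n → ℕ
    pen v = M ∸ value s v

    value< : ∀ v → value s v < M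
    value< v = subst (_< M) (ℕ.+-identityʳ _) (total< s {v ∷ []} ([] ∷ []))

    pens : List (Fin n) → ℕ
    pens X = sum (map pen X)

    -- For X without repetitions the total is below M, so the penalty is governed by the number of
    -- vertices first, and among equal numbers by the total, in reverse.
    pens+total : ∀ X → pens X + total s X ≡ length X * M
    pens+total []      = refl
    pens+total (v ∷ X) = begin
      (pen v + pens X) + (value s v + total s X)
        ≡⟨ solve 4 (λ a b c d → (a :+ b) :+ (c :+ d) := (a :+ c) :+ (b :+ d)) refl (pen v) (pens X) (value s v) (total s X) ⟩
      (pen v + value s v) + (pens X + total s X)
        ≡⟨ cong₂ _+_ (ℕ.m∸n+n≡m (ℕ.<⇒≤ (value< v))) (pens+total X) ⟩
      M + length X * M ∎
      where
      open ≡-Reasoning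
      open +-*-Solver

    -- A path has at most n vertices, each with penalty at most M and counted twice, so one unit of
    -- w outweighs any difference in penalties.
    A₀ = 2 * (n * M)

  -- Minimising κ is the same as preferring small weight, then few edges, then
  -- vertex sets that come lexicographically first.
  κ : Fin m → ℕ
  κ e = A₀ * w e + (pen (proj₁ (ends e)) + pen (proj₂ (ends e)))

  private variable
    u v x y : Fin n

  κ>0 : ∀ e → 0 < κ e
  κ>0 e = ℕ.≤-trans (ℕ.m<n⇒0<n∸m (value< (proj₁ (ends e)))) (ℕ.≤-trans (ℕ.m≤m+n _ _) (ℕ.m≤n+m _ (A₀ * w e)))

  private
    κ-joins : ∀ e → Joins ends e u v → κ e ≡ A₀ * w e + (pen u + pen v)
    κ-joins         e (inj₁ eq) = cong (λ ∙ → A₀ * w e + (pen (proj₁ ∙) + pen (proj₂ ∙))) eq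
    κ-joins {u} {v} e (inj₂ eq) = trans (cong (λ ∙ → A₀ * w e + (pen (proj₁ ∙) + pen (proj₂ ∙))) eq)
                                        (cong (A₀ * w e +_) (ℕ.+-comm (pen v) (pen u)))

  open Shortest κ κ>0

  private
    -- Each edge pays for both of its ends, so inner vertices are counted twice and the two
    -- terminals once. The correction pen u + pen v is the same for all walks from u to v.
    κ-walk : (P : Walk ends u v) → weight κ (E P) + (pen u + pen v) ≡ A₀ * weight w (E P) + 2 * pens (V P)
    κ-walk {u} [] = solve 2 (λ a p → p :+ p := a :* con 0 :+ con 2 :* (p :+ con 0)) refl A₀ (pen u)
      where open +-*-Solver
    κ-walk {u} {v} (cons {x = x} e j P) = begin
      κ e + K + (pen u + pen v)
        ≡⟨ cong (λ ∙ → ∙ + K + (pen u + pen v)) (κ-joins e j) ⟩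
      A₀ * w e + (pen u + pen x) + K + (pen u + pen v)
        ≡⟨ solve 5 (λ a pu px k pv → a :+ (pu :+ px) :+ k :+ (pu :+ pv) := a :+ con 2 :* pu :+ (k :+ (px :+ pv)))
             refl (A₀ * w e) (pen u) (pen x) K (pen v) ⟩
      A₀ * w e + 2 * pen u + (K + (pen x + pen v))
        ≡⟨ cong (A₀ * w e + 2 * pen u +_) (κ-walk P) ⟩
      A₀ * w e + 2 * pen u + (A₀ * W + 2 * S)
        ≡⟨ solve 5 (λ a we pu W S → a :* we :+ con 2 :* pu :+ (a :* W :+ con 2 :* S) := a :* (we :+ W) :+ con 2 :* (pu :+ S))
             refl A₀ (w e) (pen u) W S ⟩
      A₀ * (w e + W) + 2 * (pen u + S) ∎
      where
      open ≡-Reasoning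
      open +-*-Solver
      K = weight κ (E P)
      W = weight w (E P)
      S = pens (V P)

    pens>0 : (P : Walk ends u v) → 0 < pens (V P)
    pens>0 {u} []           = ℕ.≤-trans (ℕ.m<n⇒0<n∸m (value< u)) (ℕ.m≤m+n _ _)
    pens>0 {u} (cons _ _ _) = ℕ.≤-trans (ℕ.m<n⇒0<n∸m (value< u)) (ℕ.m≤m+n _ _)

    pens≤ : (P : Walk ends u v) → IsPath ends P → 2 * pens (V P) ≤ A₀
    pens≤ P pP = ℕ.*-monoʳ-≤ 2 (begin
      pens (V P)                  ≤⟨ ℕ.m≤m+n _ _ ⟩
      pens (V P) + total s (V P)  ≡⟨ pens+total (V P) ⟩
      length (V P) * M            ≤⟨ ℕ.*-monoˡ-≤ M (unique⇒length≤ pP) ⟩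
      n * M                       ∎)
      where open ℕ.≤-Reasoning

    decode : (P Q : Walk ends u v) → IsPath ends P → IsPath ends Q → weight κ (E P) ≤ weight κ (E Q) →
      weight w (E P) < weight w (E Q) ⊎ (weight w (E P) ≡ weight w (E Q) ×
        (length (E P) < length (E Q) ⊎ (length (E P) ≡ length (E Q) × total s (V Q) ≤ total s (V P))))
    decode {u} {v} P Q pP pQ h
      with digits A₀ (weight w (E P)) (2 * pens (V P)) (weight w (E Q)) (2 * pens (V Q))
             (ℕ.≤-trans (pens>0 P) (ℕ.m≤m+n _ _)) (pens≤ Q pQ)
             (subst₂ _≤_ (κ-walk P) (κ-walk Q) (ℕ.+-monoˡ-≤ (pen u + pen v) h))
    ... | inj₁ w< = inj₁ w<
    ... | inj₂ (w≡ , 2p≤) = inj₂ (w≡ , byLength (ℕ.<-cmp (length (E P)) (length (E Q))))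
      where
      open ℕ.≤-Reasoning
      p≤ : pens (V P) ≤ pens (V Q)
      p≤ = ℕ.*-cancelˡ-≤ 2 2p≤

      count : (P : Walk ends u v) → pens (V P) + total s (V P) ≡ M + length (E P) * M
      count P = trans (pens+total (V P)) (cong (_* M) (length-V P))

      byLength : _ → _
      byLength (tri< ℓ< _ _) = inj₁ ℓ<
      byLength (tri≈ _ ℓ≡ _) = inj₂ (ℓ≡ , ℕ.+-cancelˡ-≤ (pens (V P)) _ _ (begin
        pens (V P) + total s (V Q)  ≤⟨ ℕ.+-monoˡ-≤ (total s (V Q)) p≤ ⟩
        pens (V Q) + total s (V Q)  ≡⟨ count Q ⟩
        M + length (E Q) * M        ≡⟨ cong (λ ℓ → M + ℓ * M) ℓ≡ ⟨
        M + length (E P) * M        ≡⟨ count P ⟨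
        pens (V P) + total s (V P)  ∎))
      -- One more vertex costs M, which exceeds anything the total of a path can save.
      byLength (tri> _ _ ℓ>) = contradiction p≤ (ℕ.<⇒≱ (ℕ.+-cancelʳ-< M _ _ (begin-strict
        pens (V Q) + M              ≤⟨ ℕ.+-monoˡ-≤ M (ℕ.m≤m+n _ (total s (V Q))) ⟩
        pens (V Q) + total s (V Q) + M ≡⟨ cong (_+ M) (count Q) ⟩
        suc (length (E Q)) * M + M  ≤⟨ ℕ.+-monoˡ-≤ M (ℕ.*-monoˡ-≤ M ℓ>) ⟩
        length (E P) * M + M        ≡⟨ ℕ.+-comm _ M ⟩
        M + length (E P) * M        ≡⟨ count P ⟨
        pens (V P) + total s (V P)  <⟨ ℕ.+-monoʳ-< (pens (V P)) (total< s pP) ⟩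
        pens (V P) + M              ∎)))

    encode : (P Q : Walk ends u v) → weight w (E P) ≡ weight w (E Q) → length (E P) ≡ length (E Q) →
             total s (V P) ≡ total s (V Q) → weight κ (E P) ≡ weight κ (E Q)
    encode {u} {v} P Q w≡ ℓ≡ t≡ = ℕ.+-cancelʳ-≡ (pen u + pen v) _ _
      (trans (κ-walk P) (trans (cong₂ (λ a b → A₀ * a + 2 * b) w≡ p≡) (sym (κ-walk Q))))
      where
      p≡ : pens (V P) ≡ pens (V Q)
      p≡ = ℕ.+-cancelʳ-≡ (total s (V P)) _ _ (trans (pens+total (V P))
        (trans (cong (_* M) (trans (length-V P) (trans (cong suc ℓ≡) (sym (length-V Q)))))
          (trans (sym (pens+total (V Q))) (cong (pens (V Q) +_) (sym t≡)))))

    Beats : (P Q : Walk ends u v) → Set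
    Beats = LexBeats ends w _≺_

    beats-asym : (P Q : Walk ends u v) → Beats P Q → ¬ Beats Q P
    beats-asym P Q (inj₁ w<)              (inj₁ w>)              = ℕ.<-asym w< w>
    beats-asym P Q (inj₁ w<)              (inj₂ (inj₁ (w≡ , _))) = ℕ.<-irrefl w≡ w<
    beats-asym P Q (inj₁ w<)              (inj₂ (inj₂ (w≡ , _))) = ℕ.<-irrefl w≡ w<
    beats-asym P Q (inj₂ (inj₁ (w≡ , _))) (inj₁ w>)              = ℕ.<-irrefl w≡ w>
    beats-asym P Q (inj₂ (inj₂ (w≡ , _))) (inj₁ w>)              = ℕ.<-irrefl w≡ w>
    beats-asym P Q (inj₂ (inj₁ (_ , ℓ<)))     (inj₂ (inj₁ (_ , ℓ>)))     = ℕ.<-asym ℓ< ℓ>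
    beats-asym P Q (inj₂ (inj₁ (_ , ℓ<)))     (inj₂ (inj₂ (_ , ℓ≡ , _))) = ℕ.<-irrefl ℓ≡ ℓ<
    beats-asym P Q (inj₂ (inj₂ (_ , ℓ≡ , _))) (inj₂ (inj₁ (_ , ℓ>)))     = ℕ.<-irrefl ℓ≡ ℓ>
    beats-asym P Q (inj₂ (inj₂ (_ , _ , x , x∈P , x∉Q , x≺))) (inj₂ (inj₂ (_ , _ , y , y∈Q , y∉P , y≺))) =
      ≺.asym (x≺ y y∈Q y∉P) (y≺ x x∈P x∉Q)

    beats-weight : (P Q : Walk ends u v) → Beats P Q → weight w (E P) ≤ weight w (E Q)
    beats-weight P Q (inj₁ w<)              = ℕ.<⇒≤ w<
    beats-weight P Q (inj₂ (inj₁ (w≡ , _))) = ℕ.≤-reflexive (sym w≡)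
    beats-weight P Q (inj₂ (inj₂ (w≡ , _))) = ℕ.≤-reflexive (sym w≡)

    minimal⇒beats : (P Q : Walk ends u v) → Minimal P → IsPath ends Q → V Q ≢ V P → Beats P Q
    minimal⇒beats P Q min pQ V≢ with decode P Q (minimal⇒path P min) pQ (min Q)
    ... | inj₁ w< = inj₁ w<
    ... | inj₂ (w≡ , inj₁ ℓ<) = inj₂ (inj₁ (sym w≡ , ℓ<))
    ... | inj₂ (w≡ , inj₂ (ℓ≡ , t≥)) with compareSets _≺_ s ≺s (minimal⇒path P min) pQ
    ...   | inj₂ (inj₁ (_ , x , x∈ , x∉ , first)) =
            inj₂ (inj₂ (sym w≡ , sym ℓ≡ , x , x∈ , x∉ , λ y → first (all∈s y)))
    ...   | inj₂ (inj₂ (t< , _)) = contradiction t≥ (ℕ.<⇒≱ t<)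
    -- With all three criteria tied, Q has the same κ as P and is minimal too, so equal vertex sets
    -- force equal vertex lists.
    ...   | inj₁ (t≡ , same) = contradiction (sym (minimal-unique P Q (minimal⇒path P min) pQ min
              (λ R → subst (_≤ weight κ (E R)) (encode P Q w≡ ℓ≡ t≡) (min R))
              (λ z → proj₁ (same (all∈s z))) (λ z → proj₂ (same (all∈s z))))) V≢

    V≟ : (P Q : Walk ends u v) → Dec (V P ≡ V Q)
    V≟ P Q = ≡-dec _≟_ (V P) (V Q)

  -- `κ-unique` yields the strict descent of κ and `w-minimal` the weight bounds when a cycle is
  -- cut. Both range over all walks, so they apply to arcs of a closed walk directly.
  record Lsp (u v : Fin n) : Set where
    field
      path      : Walk ends u v
      isLSP     : IsLSP ends w _≺_ path
      κ-unique  : (Q : Walk ends u v) → weight κ (E Q) ≤ weight κ (E path) → E Q ≡ E path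
      w-minimal : (Q : Walk ends u v) → weight w (E path) ≤ weight w (E Q)

  lsp : u ≢ v → Lsp u v
  lsp {u} {v} u≢v with P , min ← minimise (connected u v) = record
    { path      = P
    ; isLSP     = u≢v , minimal⇒path P min , λ Q pQ → minimal⇒beats P Q min pQ
    ; κ-unique  = unique
    ; w-minimal = light
    }
    where
    unique : ∀ Q → weight κ (E Q) ≤ weight κ (E P) → E Q ≡ E P
    unique Q Q≤P with V≟ Q P
    ... | yes eq = V-determines-E simple Q P eq
    ... | no neq = contradiction (minimal⇒beats Q P minQ (minimal⇒path P min) (neq ∘ sym))
                     (beats-asym P Q (minimal⇒beats P Q min (minimal⇒path Q minQ) neq))
      where
      minQ : Minimal Q
      minQ R = ℕ.≤-trans Q≤P (min R)

    light : ∀ Q → weight w (E P) ≤ weight w (E Q)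
    -- The lex order is only known to compare P with paths, so Q is first shortened to a path.
    light Q with R , pR , R≤ ← pathify Q with V≟ R P
    ... | yes eq = subst (λ ∙ → weight w ∙ ≤ weight w (E Q)) (V-determines-E simple R P eq) (R≤ w)
    ... | no neq = ℕ.≤-trans (beats-weight P R (minimal⇒beats P R min pR neq)) (R≤ w)

  lsp-unique : (P Q : Walk ends u v) → IsLSP ends w _≺_ P → IsLSP ends w _≺_ Q → E P ≡ E Q
  lsp-unique P Q (_ , pP , P-beats) (_ , pQ , Q-beats) with V≟ P Q
  ... | yes eq = V-determines-E simple P Q eq
  ... | no neq = contradiction (Q-beats P pP neq) (beats-asym P Q (P-beats Q pQ (neq ∘ sym)))

-- Spanning by lex short cycles

sum-map-insert : (g h : A → ℕ) (e : A) → h e ≡ 0 → (∀ {x} → x ≢ e → g x ≡ h x) →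
  ∀ {X} → Unique X → e ∈ X → sum (map g X) ≡ g e + sum (map h X)
sum-map-insert g h e he off {x ∷ X} (x∉ ∷ _) (here refl) =
  cong (g e +_) (trans (away X x∉) (cong (_+ sum (map h X)) (sym he)))
  where
  away : ∀ X → All (e ≢_) X → sum (map g X) ≡ sum (map h X)
  away []      []         = refl
  away (y ∷ X) (e≢y ∷ e∉) = cong₂ _+_ (off (e≢y ∘ sym)) (away X e∉)
sum-map-insert g h e he off {x ∷ X} (x∉ ∷ u) (there e∈) = begin
  g x + sum (map g X)          ≡⟨ cong₂ _+_ (off (All.lookup x∉ e∈)) (sum-map-insert g h e he off u e∈) ⟩
  h x + (g e + sum (map h X))  ≡⟨ solve 3 (λ a b c → a :+ (b :+ c) := b :+ (a :+ c)) refl (h x) (g e) (sum (map h X)) ⟩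
  g e + (h x + sum (map h X))  ∎
  where
  open ≡-Reasoning
  open +-*-Solver

module _ {n m : ℕ} (ends : Fin m → Fin n × Fin n) where
  open Walks ends
  private variable
    P Q : Subset m → Set
    a b : Subset m

  span-⊞ : Span ends P a → Span ends P b → Span ends P (a ⊞ b)
  span-⊞ {P = P} {b = b} span-0 sb = subst (Span ends P) (sym (⊞-identityˡ b)) sb
  span-⊞ {P = P} {b = b} (span-+ {b = c} {v = v} pc sv) sb =
    subst (Span ends P) (sym (⊞-assoc c v b)) (span-+ pc (span-⊞ sv sb))

  span-member : P b → Span ends P b
  span-member {P = P} {b = b} pb = subst (Span ends P) (⊞-identityʳ b) (span-+ pb span-0)

  span-bind : (∀ {b} → P b → Span ends Q b) → Span ends P a → Span ends Q a
  span-bind f span-0        = span-0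
  span-bind f (span-+ pb s) = span-⊞ (f pb) (span-bind f s)

  cweight-mod2 : (w : Fin m → ℕ) {es : List (Fin m)} → Unique es → cweight ends w (mod2 es) ≡ weight w es
  cweight-mod2 w {[]} [] = zeros (allFin m)
    where
    zeros : ∀ X → sum (map (λ e → if lookup {n = m} ∅ e then w e else 0) X) ≡ 0
    zeros []      = refl
    zeros (x ∷ X) rewrite lookup-∅ x = zeros X
  cweight-mod2 w {e ∷ es} (e∉ ∷ u) = trans
    (sum-map-insert (mask (mod2 (e ∷ es))) (mask (mod2 es)) e
      (cong (λ β → if β then w e else 0) (∉⇒mod2 λ e∈ → All.lookup e∉ e∈ refl))
      (λ {x} x≢e → cong (λ β → if β then w x else 0)
        (trans (lookup-⊞ ⁅ e ⁆ (mod2 es) x) (cong (_xor lookup (mod2 es) x) (lookup-⁅⁆-≢ x≢e))))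
      (Unique.allFin⁺ m) (∈-allFin e))
    (cong₂ _+_ (cong (λ β → if β then w e else 0) (∈⇒mod2 (e∉ ∷ u) (here refl))) (cweight-mod2 w u))
    where
    mask : Subset m → Fin m → ℕ
    mask S x = if lookup S x then w x else 0

  cycle-mod2 : ∀ {S} → IsCycle ends S → ∃ λ u → Σ (Walk ends u u) λ C → Unique (E C) × S ≡ mod2 (E C)
  cycle-mod2 {S} (u , x , e , j , P , pP , 2≤ , S⇔) = u , cons e j P , uniq , ⊑-antisym
      (λ i h → ∈⇒mod2 uniq (Equivalence.to (S⇔ i) (Vec.lookup⇒[]= i S h)))
      (λ i h → Vec.[]=⇒lookup (Equivalence.from (S⇔ i) (mod2⇒∈ h)))
    where
    uniq = closed-unique-E P pP 2≤ j

  -- The closed walk is rotated to start at x and then cut at y.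
  arcs : ∀ {u x y e e′} (C : Walk ends u u) →
    e ∈ E C → (proj₁ (ends e) ≡ x) ⊎ (proj₂ (ends e) ≡ x) →
    e′ ∈ E C → (proj₁ (ends e′) ≡ y) ⊎ (proj₂ (ends e′) ≡ y) →
    Σ (Walk ends x y) λ A → Σ (Walk ends y x) λ B → E C ↭ E A ++ E B
  arcs C e∈ ex e′∈ ey with Q , R , eq ← splitAt C (ends∈V C e∈ ex)
    with rot ← ↭-trans (↭-reflexive eq) (↭-trans (↭.++-comm (E Q) (E R)) (↭-reflexive (sym (E-◅◅ R Q))))
    with A , B , eq′ ← splitAt (R ◅◅ Q) (ends∈V (R ◅◅ Q) (↭.∈-resp-↭ rot e′∈) ey)
    = A , B , ↭-trans rot (↭-reflexive eq′)

module Spanning {n m : ℕ} (ends : Fin m → Fin n × Fin n) (w : Fin m → ℕ)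
  (_≺_ : Fin n → Fin n → Set) (sto : IsStrictTotalOrder _≡_ _≺_)
  (simple : Simple ends) (connected : Connected ends)
  (L : List (Subset m)) (L⇔ : ∀ S → (S ∈ L) ⇔ (IsCycle ends S × LexShort ends w _≺_ S)) where

  open Walks ends
  open LexShortest ends w _≺_ sto simple connected

  private
    -- The default `[]` for equal vertices ensures that such a pair never counts as a shortcut.
    lspE : Fin n → Fin n → List (Fin m)
    lspE x y with x ≟ y
    ... | yes _  = []
    ... | no x≢y = E (Lsp.path (lsp x≢y))

    Shortcut : Subset m → Fin n → Fin n → Set
    Shortcut S x y = InV ends S x × InV ends S y × Any (λ e → lookup S e ≡ false) (lspE x y)

    inV? : ∀ S x → Dec (InV ends S x)
    inV? S x = Fin.any? λ e → map′ (Vec.lookup⇒[]= e S) Vec.[]=⇒lookup (lookup S e 𝔹.≟ true) ×-dec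
      ((proj₁ (ends e) ≟ x) ⊎-dec (proj₂ (ends e) ≟ x))

    shortcut? : ∀ S → Dec (∃ λ x → ∃ λ y → Shortcut S x y)
    shortcut? S = Fin.any? λ x → Fin.any? λ y →
      inV? S x ×-dec inV? S y ×-dec Any.any? (λ e → lookup S e 𝔹.≟ false) (lspE x y)

    lspE≡ : ∀ {x y} → x ≢ y → (P : Walk ends x y) → IsLSP ends w _≺_ P → lspE x y ≡ E P
    lspE≡ {x} {y} x≢y P isLSP with x ≟ y
    ... | yes x≡y = contradiction x≡y x≢y
    ... | no x≢y′ = lsp-unique _ P (Lsp.isLSP (lsp x≢y′)) isLSP

    no-shortcut⇒lexShort : ∀ S → ¬ (∃ λ x → ∃ λ y → Shortcut S x y) → LexShort ends w _≺_ S
    no-shortcut⇒lexShort S none x y Sx Sy x≢y P isLSP e e∈ with lookup S e in eq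
    ... | true  = Vec.lookup⇒[]= e S eq
    ... | false = contradiction
      (x , y , Sx , Sy , lose (subst (e ∈_) (sym (lspE≡ x≢y P isLSP)) e∈) eq) none

    shortcut-lsp : ∀ {S x y} → Shortcut S x y → Σ (Lsp x y) λ P → ∃ λ e → e ∈ E (Lsp.path P) × lookup S e ≡ false
    shortcut-lsp {S} {x} {y} (_ , _ , some) with x ≟ y
    ... | no x≢y with e , e∈ , eq ← find some = lsp x≢y , e , e∈ , eq

    Light : ℕ → Subset m → Set
    Light W b = b ∈ L × cweight ends w b ≤ W

    -- Formulated for closed walks, because cutting a cycle along a path that may meet it again need
    -- not produce cycles.
    Reduced : ∀ {u} → Walk ends u u → Set
    Reduced C = Span ends (Light (weight w (E C))) (mod2 (E C))

    combine : ∀ {u x y} (C : Walk ends u u) (C₁ : Walk ends x x) (C₂ : Walk ends y y) →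
      mod2 (E C₁) ⊞ mod2 (E C₂) ≡ mod2 (E C) →
      weight w (E C₁) ≤ weight w (E C) → weight w (E C₂) ≤ weight w (E C) →
      Reduced C₁ → Reduced C₂ → Reduced C
    combine C C₁ C₂ eq w₁ w₂ r₁ r₂ = subst (Span ends (Light (weight w (E C)))) eq (span-⊞ ends (relax w₁ r₁) (relax w₂ r₂))
      where
      relax : ∀ {W W′ v} → W ≤ W′ → Span ends (Light W) v → Span ends (Light W′) v
      relax W≤ = span-bind ends λ (b∈ , b≤) → span-member ends (b∈ , ℕ.≤-trans b≤ W≤)

    reduce : ∀ k {u} (C : Walk ends u u) → weight κ (E C) < k → Reduced C

    reduce-cycle : ∀ k {u} (C : Walk ends u u) → weight κ (E C) < suc k →
      Unique (E C) → IsCycle ends (mod2 (E C)) → Reduced C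
    reduce-cycle k {u} C C<k uniq cyc with _∈?_ (Vec.≡-dec 𝔹._≟_) (mod2 (E C)) L
    ... | yes C∈L = span-member ends (C∈L , ℕ.≤-reflexive (cweight-mod2 ends w uniq))
    ... | no  C∉L with shortcut? (mod2 (E C))
    ...   | no  none = contradiction (Equivalence.from (L⇔ _) (cyc , no-shortcut⇒lexShort _ none)) C∉L
    ...   | yes (x , y , sc@((e₁ , e₁∈ , e₁x) , (e₂ , e₂∈ , e₂y) , _))
      with lspxy , e , e∈P , e∉C ← shortcut-lsp sc
      with A , B , C↭ ← arcs ends C (mod2⇒∈ (Vec.[]=⇒lookup e₁∈)) e₁x (mod2⇒∈ (Vec.[]=⇒lookup e₂∈)) e₂y
      -- P replaces one arc in each piece and cancels in their sum.
      = combine C (P ◅◅ B) (A ◅◅ reverse P) mod2-eq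
          (subst₂ _≤_ (sym (weight-PB w)) (sym (weight-C w)) (ℕ.+-monoˡ-≤ (weight w (E B)) (w-minimal A)))
          (subst₂ _≤_ (sym (weight-AP w)) (sym (weight-C w)) (ℕ.+-monoʳ-≤ (weight w (E A)) (w≤ B)))
          (reduce k (P ◅◅ B) (ℕ.<-≤-trans
            (subst₂ _<_ (sym (weight-PB κ)) (sym (weight-C κ)) (ℕ.+-monoˡ-< (weight κ (E B)) κ<A)) (ℕ.≤-pred C<k)))
          (reduce k (A ◅◅ reverse P) (ℕ.<-≤-trans
            (subst₂ _<_ (sym (weight-AP κ)) (sym (weight-C κ)) (ℕ.+-monoʳ-< (weight κ (E A)) κ<B)) (ℕ.≤-pred C<k)))
      where
      open Lsp lspxy renaming (path to P)

      weight-PB : ∀ f → weight f (E (P ◅◅ B)) ≡ weight f (E P) + weight f (E B)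
      weight-PB f = trans (cong (weight f) (E-◅◅ P B)) (weight-++ f (E P) (E B))

      weight-AP : ∀ f → weight f (E (A ◅◅ reverse P)) ≡ weight f (E A) + weight f (E P)
      weight-AP f = trans (cong (weight f) (E-◅◅ A (reverse P)))
        (trans (weight-++ f (E A) _) (cong (weight f (E A) +_) (weight-↭ f (E-reverse P))))

      weight-C : ∀ f → weight f (E C) ≡ weight f (E A) + weight f (E B)
      weight-C f = weight-↭-++ f (E A) (E B) C↭

      w≤ : ∀ B → weight w (E P) ≤ weight w (E B)
      w≤ B = subst (weight w (E P) ≤_) (weight-↭ w (E-reverse B)) (w-minimal (reverse B))

      -- P has an edge e outside C, so neither arc can be P; by `κ-unique` both arcs are then
      -- strictly κ-heavier.
      not-on-C : ∀ {es} → (∀ {i} → i ∈ es → i ∈ E C) → es ≢ E P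
      not-on-C sub refl = contradiction (trans (sym e∉C) (∈⇒mod2 uniq (sub e∈P))) λ ()

      κ<A : weight κ (E P) < weight κ (E A)
      κ<A = ℕ.≰⇒> λ A≤ → not-on-C (λ i∈ → ↭.∈-resp-↭ (↭-sym C↭) (∈-++⁺ˡ i∈)) (κ-unique A A≤)

      κ<B : weight κ (E P) < weight κ (E B)
      κ<B = ℕ.≰⇒> λ B≤ → not-on-C
        (λ i∈ → ↭.∈-resp-↭ (↭-sym C↭) (∈-++⁺ʳ (E A) (↭.∈-resp-↭ (E-reverse B) i∈)))
        (κ-unique (reverse B) (subst (_≤ weight κ (E P)) (sym (weight-↭ κ (E-reverse B))) B≤))

      mod2-eq : mod2 (E (P ◅◅ B)) ⊞ mod2 (E (A ◅◅ reverse P)) ≡ mod2 (E C)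
      mod2-eq = begin
        mod2 (E (P ◅◅ B)) ⊞ mod2 (E (A ◅◅ reverse P))
          ≡⟨ cong₂ _⊞_ (trans (cong mod2 (E-◅◅ P B)) (mod2-++ (E P) (E B)))
               (trans (cong mod2 (E-◅◅ A (reverse P))) (trans (mod2-++ (E A) _) (cong (mod2 (E A) ⊞_) (mod2-↭ (E-reverse P))))) ⟩
        (p ⊞ b) ⊞ (a ⊞ p)  ≡⟨ cong ((p ⊞ b) ⊞_) (⊞-comm a p) ⟩
        (p ⊞ b) ⊞ (p ⊞ a)  ≡⟨ ⊞-interchange p b p a ⟩
        (p ⊞ p) ⊞ (b ⊞ a)  ≡⟨ cong₂ _⊞_ (⊞-same p) (⊞-comm b a) ⟩
        ∅ ⊞ (a ⊞ b)        ≡⟨ ⊞-identityˡ _ ⟩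
        a ⊞ b              ≡⟨ mod2-++ (E A) (E B) ⟨
        mod2 (E A ++ E B)  ≡⟨ mod2-↭ C↭ ⟨
        mod2 (E C)         ∎
        where
        open ≡-Reasoning
        p = mod2 (E P)
        a = mod2 (E A)
        b = mod2 (E B)

    weight>0 : ∀ {u v} (P : Walk ends u v) → 0 < length (E P) → 0 < weight κ (E P)
    weight>0 (cons e _ _) _ = ℕ.≤-trans (κ>0 e) (ℕ.m≤m+n _ _)

    reduce (suc k) []             C<k = span-0
    reduce (suc k) C@(cons e j P) C<k with findLoop P
    -- Both pieces are nonempty, the second because it still contains e, so each is κ-smaller than
    -- C.
    ... | inj₂ (_ , B , Q , 0<B , p) = combine C B C′
          (trans (sym (mod2-++ (E B) (E C′))) (sym (mod2-↭ C↭)))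
          (subst (weight w (E B) ≤_) (sym (weight-C w)) (ℕ.m≤m+n _ _))
          (subst (weight w (E C′) ≤_) (sym (weight-C w)) (ℕ.m≤n+m _ (weight w (E B))))
          (reduce k B (ℕ.<-≤-trans (subst (weight κ (E B) <_) (sym (weight-C κ))
            (ℕ.m<m+n (weight κ (E B)) (weight>0 C′ (s≤s z≤n)))) (ℕ.≤-pred C<k)))
          (reduce k C′ (ℕ.<-≤-trans (subst (weight κ (E C′) <_) (sym (weight-C κ))
            (ℕ.m<n+m (weight κ (E C′)) (weight>0 B 0<B))) (ℕ.≤-pred C<k)))
      where
      C′ = cons e j Q

      C↭ : E C ↭ E B ++ E C′
      C↭ = ↭-trans (↭.prep e p) (↭-sym (↭.shift e (E B) (E Q)))

      weight-C : ∀ f → weight f (E C) ≡ weight f (E B) + weight f (E C′)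
      weight-C f = weight-↭-++ f (E B) (E C′) C↭
    reduce (suc k) (cons e j []) C<k | inj₁ pP = contradiction ([ loop , loop ]′ j) (proj₁ simple e)
      where
      loop : ∀ {u} → ends e ≡ (u , u) → proj₁ (ends e) ≡ proj₂ (ends e)
      loop eq = trans (cong proj₁ eq) (sym (cong proj₂ eq))
    -- By simplicity a closed walk with two edges traverses one edge twice and vanishes modulo 2.
    reduce (suc k) (cons e j (cons e′ j′ [])) C<k | inj₁ pP
      with refl ← proj₂ simple e e′ _ _ j (Sum.swap j′) =
      subst (Span ends _) (sym (⊞-cancel ⁅ e ⁆ ∅)) span-0
    reduce (suc k) C@(cons e j P@(cons _ _ (cons _ _ _))) C<k | inj₁ pP =
      reduce-cycle k C C<k uniq (_ , _ , e , j , P , pP , s≤s (s≤s z≤n) ,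
        λ i → mk⇔ (λ i∈ → mod2⇒∈ (Vec.[]=⇒lookup i∈)) (λ i∈ → Vec.lookup⇒[]= i _ (∈⇒mod2 uniq i∈)))
      where
      uniq = closed-unique-E P pP (s≤s (s≤s z≤n)) j

  spanned : ∀ {S} → IsCycle ends S → Span ends (λ b → b ∈ L × cweight ends w b ≤ cweight ends w S) S
  spanned cyc with u , C , uniq , refl ← cycle-mod2 ends cyc =
    subst (λ W → Span ends (Light W) (mod2 (E C))) (sym (cweight-mod2 ends w uniq)) (reduce _ C ℕ.≤-refl)

-- Cycles as circuits of a 2-tree

inc-≢ : {u v y : Fin n} → y ≢ u → y ≢ v → inc (u , v) y ≡ false
inc-≢ {u = u} {v} {y} y≢u y≢v = cong₂ _xor_ (dec-false (u ≟ y) (y≢u ∘ sym)) (dec-false (v ≟ y) (y≢v ∘ sym))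

inc-left : {u v : Fin n} → u ≢ v → inc (u , v) u ≡ true
inc-left {u = u} {v} u≢v = cong₂ _xor_ (dec-true (u ≟ u) refl) (dec-false (v ≟ u) (u≢v ∘ sym))

inc-right : {u v : Fin n} → u ≢ v → inc (u , v) v ≡ true
inc-right {u = u} {v} u≢v = cong₂ _xor_ (dec-false (u ≟ v) u≢v) (dec-true (v ≟ v) refl)

inc-chain : ∀ (u x v z : Fin n) → inc (u , x) z xor inc (x , v) z ≡ inc (u , v) z
inc-chain u x v z with does (u ≟ z) | does (x ≟ z)
... | a | b = trans (𝔹.xor-assoc a b _) (cong (a xor_)
  (trans (sym (𝔹.xor-assoc b b _)) (cong (_xor does (v ≟ z)) (𝔹.xor-same b))))

inc-injective : {f : Fin n → Fin k} → Injective _≡_ _≡_ f → ∀ u v y → inc (f u , f v) (f y) ≡ inc (u , v) y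
inc-injective {f = f} f-inj u v y = cong₂ _xor_ (same u) (same v)
  where
  same : ∀ u → does (f u ≟ f y) ≡ does (u ≟ y)
  same u = does-⇔ (mk⇔ f-inj (cong f)) (f u ≟ f y) (u ≟ y)

∂-clear : (ends : Fin m → Fin n × Fin n) (D : Subset m) (t : Fin m) (x : Fin n) →
  ∂ ends D x ≡ (lookup D t ∧ inc (ends t) x) xor ∂ ends (D [ t ]≔ false) x
∂-clear ends (s ∷ D) zero    x = refl
∂-clear ends (s ∷ D) (suc t) x = begin
  a xor ∂ _ D x           ≡⟨ cong (a xor_) (∂-clear (ends ∘ suc) D t x) ⟩
  a xor (b xor r)         ≡⟨ 𝔹.xor-assoc a b r ⟨
  (a xor b) xor r         ≡⟨ cong (_xor r) (𝔹.xor-comm a b) ⟩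
  (b xor a) xor r         ≡⟨ 𝔹.xor-assoc b a r ⟩
  b xor (a xor r)         ∎
  where
  open ≡-Reasoning
  a = s ∧ inc (ends zero) x
  b = lookup D t ∧ inc (ends (suc t)) x
  r = ∂ (ends ∘ suc) (D [ t ]≔ false) x

-- Even subsets of a cycle

module CycleBoundary {n m : ℕ} (ends : Fin m → Fin n × Fin n) (d : Fin m → Bool) where
  open Walks ends
  private variable
    u x : Fin n

  -- The boundary of the edges selected by d, summed in the order of a list so that it can be
  -- followed along a walk.
  bd : List (Fin m) → Fin n → Bool
  bd []       y = false
  bd (e ∷ es) y = (d e ∧ inc (ends e) y) xor bd es y

  private
    skip : ∀ {e u x y} → Joins ends e u x → y ≢ u → y ≢ x → ∀ es → bd (e ∷ es) y ≡ bd es y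
    skip {e} {y = y} j y≢u y≢x es = cong (_xor bd es y)
      (trans (cong (d e ∧_) (trans (inc-joins ends j y) (inc-≢ y≢u y≢x))) (𝔹.∧-zeroʳ (d e)))

    hit : ∀ {e u x y} → Joins ends e u x → inc (u , x) y ≡ true → ∀ es → bd (e ∷ es) y ≡ d e xor bd es y
    hit {e} {y = y} j inc≡ es = cong (_xor bd es y)
      (trans (cong (d e ∧_) (trans (inc-joins ends j y) inc≡)) (𝔹.∧-identityʳ (d e)))

  bd-∉ : ∀ {y} (P : Walk ends x u) → y ∉ V P → bd (E P) y ≡ false
  bd-∉ []           y∉ = refl
  bd-∉ (cons e j P) y∉ = trans (skip j (λ { refl → y∉ (here refl) }) (λ { refl → y∉ (there (start∈V P)) }) (E P))
                               (bd-∉ P (y∉ ∘ there))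

  -- At every inner vertex the two path edges have the same coefficient.
  constant-on-path : ∀ {e} (j : Joins ends e u x) {v} (P : Walk ends x v) → IsPath ends (cons e j P) →
    (∀ y → y ≢ u → y ≢ v → bd (E (cons e j P)) y ≡ false) →
    All (λ e′ → d e′ ≡ d e) (E P) × bd (E (cons e j P)) u ≡ d e
  constant-on-path {u} {x} {e} j {v} P (u∉ ∷ pP) hyp = rest P u∉ pP hyp , (begin
      bd (e ∷ E P) u       ≡⟨ hit j (inc-left (All.lookup u∉ (start∈V P))) (E P) ⟩
      d e xor bd (E P) u   ≡⟨ cong (d e xor_) (bd-∉ P (λ u∈ → All.lookup u∉ u∈ refl)) ⟩
      d e xor false        ≡⟨ 𝔹.xor-identityʳ (d e) ⟩
      d e                  ∎)
    where
    open ≡-Reasoning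
    rest : (P : Walk ends x v) → All (u ≢_) (V P) → IsPath ends P →
      (∀ y → y ≢ u → y ≢ v → bd (e ∷ E P) y ≡ false) → All (λ e′ → d e′ ≡ d e) (E P)
    rest []               u∉ pP hyp = []
    rest (cons e′ j′ P′) u∉ pP@(x∉ ∷ _) hyp =
      sym de≡ ∷ All.map (λ eq → trans eq (sym de≡)) (proj₁ ih)
      where
      inner : ∀ y → y ≢ x → y ≢ v → bd (e′ ∷ E P′) y ≡ false
      inner y y≢x y≢v with y ≟ u
      ... | yes refl = bd-∉ (cons e′ j′ P′) λ u∈ → All.lookup u∉ u∈ refl
      ... | no  y≢u  = trans (sym (skip j y≢u y≢x (e′ ∷ E P′))) (hyp y y≢u y≢v)

      ih = constant-on-path j′ P′ pP inner

      u≢x : u ≢ x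
      u≢x = All.lookup u∉ (here refl)

      de≡ : d e ≡ d e′
      de≡ = xor-false (trans (sym (trans (hit j (inc-right u≢x) (e′ ∷ E P′)) (cong (d e xor_) (proj₂ ih))))
                             (hyp x (u≢x ∘ sym) (All.lookup x∉ (end∈V P′))))

  -- Hence an even subset of a cycle is empty or the whole cycle, which is the minimality required
  -- of circuits.
  constant-on-cycle : ∀ {e} (j : Joins ends e u x) (P : Walk ends x u) → IsPath ends P → 2 ≤ length (E P) →
    (∀ y → bd (e ∷ E P) y ≡ false) → All (λ e′ → d e′ ≡ d e) (e ∷ E P)
  constant-on-cycle {u} {x} {e} j (cons e₁ j₁ P) pP@(x∉ ∷ _) _ hyp = refl ∷ sym de≡ ∷ All.map (λ eq → trans eq (sym de≡)) (proj₁ const)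
    where
    x≢u : x ≢ u
    x≢u = All.lookup x∉ (end∈V P)

    const = constant-on-path j₁ P pP λ y y≢x y≢u → trans (sym (skip j y≢u y≢x (e₁ ∷ E P))) (hyp y)

    de≡ : d e ≡ d e₁
    de≡ = xor-false (trans (sym (trans (hit j (inc-right (x≢u ∘ sym)) (e₁ ∷ E P)) (cong (d e xor_) (proj₂ const)))) (hyp x))

-- Transport along the embedding into a 2-tree

module Embedding {n m k : ℕ} (ends : Fin m → Fin n × Fin n) (simple : Simple ends) (T : TwoTree k) (f : Fin n → Fin k)
  (f-inj : Injective _≡_ _≡_ f) (adj : ∀ e → TTAdj T (f (proj₁ (ends e))) (f (proj₂ (ends e)))) where
  open Walks ends

  g : Fin m → Fin (size T)
  g e = proj₁ (edge T (adj e))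

  private
    pair-injective : ∀ {p q : Fin n × Fin n} → Product.map f f p ≡ Product.map f f q → p ≡ q
    pair-injective eq = cong₂ _,_ (f-inj (cong proj₁ eq)) (f-inj (cong proj₂ eq))

  g-joins : ∀ {e u v} → Joins ends e u v → Joins (tends T) (g e) (f u) (f v)
  g-joins {e} (inj₁ refl) = proj₂ (edge T (adj e))
  g-joins {e} (inj₂ refl) = Sum.swap (proj₂ (edge T (adj e)))

  g-reflects : ∀ {e u v} → Joins (tends T) (g e) (f u) (f v) → Joins ends e u v
  g-reflects {e} h with proj₂ (edge T (adj e)) | h
  ... | inj₁ eq | inj₁ eq′ = inj₁ (pair-injective (trans (sym eq) eq′))
  ... | inj₁ eq | inj₂ eq′ = inj₂ (pair-injective (trans (sym eq) eq′))
  ... | inj₂ eq | inj₁ eq′ = inj₂ (pair-injective (cong Product.swap (trans (sym eq) eq′)))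
  ... | inj₂ eq | inj₂ eq′ = inj₁ (pair-injective (cong Product.swap (trans (sym eq) eq′)))

  g-inj : ∀ {e e′} → g e ≡ g e′ → e ≡ e′
  g-inj {e} {e′} eq = proj₂ simple e e′ _ _ (inj₁ refl)
    (g-reflects (subst (λ t → Joins (tends T) t _ _) eq (g-joins {e} (inj₁ refl))))

  private
    source : ∀ t → Dec (∃ λ e → g e ≡ t)
    source t = Fin.any? λ e → g e ≟ t

    at : Subset m → ∀ {t} → Dec (∃ λ e → g e ≡ t) → Bool
    at S (yes (e , _)) = lookup S e
    at S (no _)        = false

  -- Extension by zero along the edge map g; as g is injective, the preimage found by `source` is
  -- the only one.
  push : Subset m → Subset (size T)
  push S = tabulate λ t → at S (source t)

  lookup-push : ∀ S e → lookup (push S) (g e) ≡ lookup S e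
  lookup-push S e = trans (Vec.lookup∘tabulate (λ t → at S (source t)) (g e)) at-g
    where
    at-g : at S (source (g e)) ≡ lookup S e
    at-g with source (g e)
    ... | yes (e′ , eq) = cong (lookup S) (g-inj eq)
    ... | no none       = contradiction (e , refl) none

  push-source : ∀ S {t} → lookup (push S) t ≡ true → ∃ λ e → t ≡ g e × lookup S e ≡ true
  push-source S {t} h with source t | trans (sym (Vec.lookup∘tabulate (λ t → at S (source t)) t)) h
  ... | yes (e , eq) | Se = e , sym eq , Se

  push-∅ : push ∅ ≡ ∅
  push-∅ = lookup-ext λ t → trans (Vec.lookup∘tabulate (λ t → at ∅ (source t)) t) (trans (go (source t)) (sym (lookup-∅ t)))
    where
    go : ∀ {t} (s : Dec (∃ λ e → g e ≡ t)) → at ∅ s ≡ false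
    go (yes (e , _)) = lookup-∅ e
    go (no _)        = refl

  push-⊞ : ∀ S S′ → push (S ⊞ S′) ≡ push S ⊞ push S′
  push-⊞ S S′ = lookup-ext λ t → begin
    lookup (push (S ⊞ S′)) t                 ≡⟨ Vec.lookup∘tabulate (λ t → at (S ⊞ S′) (source t)) t ⟩
    at (S ⊞ S′) (source t)                   ≡⟨ go (source t) ⟩
    at S (source t) xor at S′ (source t)
      ≡⟨ cong₂ _xor_ (Vec.lookup∘tabulate (λ t → at S (source t)) t) (Vec.lookup∘tabulate (λ t → at S′ (source t)) t) ⟨
    lookup (push S) t xor lookup (push S′) t ≡⟨ lookup-⊞ (push S) (push S′) t ⟨
    lookup (push S ⊞ push S′) t              ∎
    where
    open ≡-Reasoning
    go : ∀ {t} (s : Dec (∃ λ e → g e ≡ t)) → at (S ⊞ S′) s ≡ at S s xor at S′ s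
    go (yes (e , _)) = lookup-⊞ S S′ e
    go (no _)        = refl

  push-⨁ : ∀ F → push (⨁ F) ≡ ⨁ (map push F)
  push-⨁ []      = push-∅
  push-⨁ (S ∷ F) = trans (push-⊞ S (⨁ F)) (cong (push S ⊞_) (push-⨁ F))

  push-injective : ∀ {S S′} → push S ≡ push S′ → S ≡ S′
  push-injective {S} {S′} eq = lookup-ext λ e →
    trans (sym (lookup-push S e)) (trans (cong (λ ∙ → lookup ∙ (g e)) eq) (lookup-push S′ e))

  push-⁅⁆ : ∀ e → push ⁅ e ⁆ ≡ ⁅ g e ⁆
  push-⁅⁆ e = ⊑-antisym to from
    where
    to : push ⁅ e ⁆ ⊑ ⁅ g e ⁆
    to t h with e′ , refl , h′ ← push-source ⁅ e ⁆ h with refl ← lookup-⁅⁆⇒≡ e h′ = lookup-⁅⁆ (g e)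

    from : ⁅ g e ⁆ ⊑ push ⁅ e ⁆
    from t h with refl ← lookup-⁅⁆⇒≡ (g e) h = trans (lookup-push ⁅ e ⁆ e) (lookup-⁅⁆ e)

  push-mod2 : ∀ es → push (mod2 es) ≡ mod2 (map g es)
  push-mod2 []       = push-∅
  push-mod2 (e ∷ es) = trans (push-⊞ ⁅ e ⁆ (mod2 es)) (cong₂ _⊞_ (push-⁅⁆ e) (push-mod2 es))

  ∂-walk : ∀ {u v} (P : Walk ends u v) z → ∂ (tends T) (mod2 (map g (E P))) z ≡ inc (f u , f v) z
  ∂-walk {u} []               z = trans (∂-∅ (tends T) z) (sym (𝔹.xor-same (does (f u ≟ z))))
  ∂-walk {u} {v} (cons {x = x} e j P) z = trans (∂-⊞ (tends T) ⁅ g e ⁆ (mod2 (map g (E P))) z)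
    (trans (cong₂ _xor_ (trans (∂-⁅⁆ (tends T) (g e) z) (inc-joins (tends T) (g-joins j) z)) (∂-walk P z))
           (inc-chain (f u) (f x) (f v) z))

  private
    bd : (Fin m → Bool) → List (Fin m) → Fin n → Bool
    bd d = CycleBoundary.bd ends d

    bd-cong : ∀ {d d′} es y → (∀ {e} → e ∈ es → d e ≡ d′ e) → bd d es y ≡ bd d′ es y
    bd-cong []       y h = refl
    bd-cong (e ∷ es) y h = cong₂ (λ a b → (a ∧ inc (ends e) y) xor b) (h (here refl)) (bd-cong es y (h ∘ there))

  -- The edges of `es` are cleared from D one by one; by uniqueness and injectivity of g this leaves
  -- the later coefficients intact.
  ∂-supported : ∀ {es} → Unique es → ∀ D → (∀ {t} → lookup D t ≡ true → ∃ λ e → t ≡ g e × e ∈ es) →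
    ∀ y → ∂ (tends T) D (f y) ≡ bd (lookup D ∘ g) es y
  ∂-supported {[]} [] D sup y = trans (cong (λ ∙ → ∂ (tends T) ∙ (f y)) D≡∅) (∂-∅ (tends T) (f y))
    where
    D≡∅ : D ≡ ∅
    D≡∅ = ⊑-antisym (λ t h → contradiction (proj₂ (proj₂ (sup h))) λ ())
                    (λ t h → contradiction (trans (sym (lookup-∅ t)) h) λ ())
  ∂-supported {e ∷ es} (e∉ ∷ u) D sup y = trans (∂-clear (tends T) D (g e) (f y)) (cong₂ _xor_
      (cong (lookup D (g e) ∧_) (trans (inc-joins (tends T) (g-joins {e} (inj₁ refl)) (f y)) (inc-injective f-inj _ _ y)))
      (trans (∂-supported u D′ sup′ y) (bd-cong es y λ e′∈ → Vec.lookup∘update′ (λ eq → All.lookup e∉ e′∈ (g-inj (sym eq))) D false)))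
    where
    D′ = D [ g e ]≔ false

    sup′ : ∀ {t} → lookup D′ t ≡ true → ∃ λ e → t ≡ g e × e ∈ es
    sup′ {t} h with t ≟ g e
    ... | yes refl = contradiction (trans (sym h) (Vec.lookup∘update (g e) D false)) λ ()
    ... | no t≢ with sup (trans (sym (Vec.lookup∘update′ t≢ D false)) h)
    ...   | e′ , eq , here refl = contradiction eq t≢
    ...   | e′ , eq , there e′∈ = e′ , eq , e′∈

  cycle⇒circuit : ∀ {S} → IsCycle ends S → Circuit T (push S)
  cycle⇒circuit {S} cyc@(u , x , e , j , P , pP , 2≤ , S⇔) = nonempty , even , minimal
    where
    C = cons e j P
    uniq = closed-unique-E P pP 2≤ j

    ∈C : ∀ {i} → lookup S i ≡ true → i ∈ E C
    ∈C {i} h = Equivalence.to (S⇔ i) (Vec.lookup⇒[]= i S h)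

    C∈ : ∀ {i} → i ∈ E C → lookup S i ≡ true
    C∈ {i} i∈ = Vec.[]=⇒lookup (Equivalence.from (S⇔ i) i∈)

    S≡ : S ≡ mod2 (E C)
    S≡ = ⊑-antisym (λ i h → ∈⇒mod2 uniq (∈C h)) (λ i h → C∈ (mod2⇒∈ h))

    nonempty : push S ≢ ∅
    nonempty eq = contradiction (trans (sym (trans (lookup-push S e) (C∈ (here refl))))
      (trans (cong (λ ∙ → lookup ∙ (g e)) eq) (lookup-∅ (g e)))) λ ()

    even : Even T (push S)
    even z = trans (cong (λ ∙ → ∂ (tends T) ∙ z) (trans (cong push S≡) (push-mod2 (E C))))
      (trans (∂-walk C z) (𝔹.xor-same (does (f u ≟ z))))

    minimal : ∀ D → D ⊑ push S → Even T D → D ≢ ∅ → D ≡ push S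
    minimal D D⊑ D-even D≢∅ = ⊑-antisym D⊑ S⊑
      where
      sup : ∀ {t} → lookup D t ≡ true → ∃ λ e → t ≡ g e × e ∈ E C
      sup {t} h with e′ , eq , Se ← push-source S (D⊑ t h) = e′ , eq , ∈C Se

      -- D has no boundary at any vertex of the cycle, so its coefficients agree all along it.
      const : All (λ e′ → lookup D (g e′) ≡ lookup D (g e)) (E C)
      const = CycleBoundary.constant-on-cycle ends (lookup D ∘ g) j P pP 2≤
        λ y → trans (sym (∂-supported uniq D sup y)) (D-even (f y))

      De : lookup D (g e) ≡ true
      De with lookup D (g e) in eq
      ... | true  = refl
      ... | false = contradiction (lookup-ext λ t → trans (≢true⇒false (none t)) (sym (lookup-∅ t))) D≢∅
        where
        none : ∀ t → lookup D t ≢ true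
        none t h with e′ , refl , e′∈ ← sup h =
          contradiction (trans (sym h) (trans (All.lookup const e′∈) eq)) λ ()

      S⊑ : push S ⊑ D
      S⊑ t h with e′ , refl , Se ← push-source S h = trans (All.lookup const (∈C Se)) De

  touches-push : ∀ S {x} → Touches T (push S) x → ∃ λ x₀ → x ≡ f x₀ × InV ends S x₀
  touches-push S (t , h , tx) with e , refl , Se ← push-source S h with tends T (g e) | proj₂ (edge T (adj e)) | tx
  ... | _ | inj₁ refl | inj₁ refl = _ , refl , e , Vec.lookup⇒[]= e S Se , inj₁ refl
  ... | _ | inj₁ refl | inj₂ refl = _ , refl , e , Vec.lookup⇒[]= e S Se , inj₂ refl
  ... | _ | inj₂ refl | inj₁ refl = _ , refl , e , Vec.lookup⇒[]= e S Se , inj₂ refl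
  ... | _ | inj₂ refl | inj₂ refl = _ , refl , e , Vec.lookup⇒[]= e S Se , inj₁ refl

module _ {n m : ℕ} (ends : Fin m → Fin n × Fin n) (w : Fin m → ℕ)
  (_≺_ : Fin n → Fin n → Set) (sto : IsStrictTotalOrder _≡_ _≺_)
  (simple : Simple ends) (connected : Connected ends) where
  open Walks ends
  open LexShortest ends w _≺_ sto simple connected

  lexShort-independent : PartialTwoTree ends → ∀ F → Unique F → All (λ S → IsCycle ends S × LexShort ends w _≺_ S) F →
    ⨁ F ≡ ∅ → F ≡ []
  lexShort-independent (k , T , f , f-inj , adj) F uniq good sum = empty (independent T (map push F)
      (Unique.map⁺ push-injective uniq) (All.map⁺ (All.map (cycle⇒circuit ∘ proj₁) good)) linked
      (trans (sym (push-⨁ F)) (trans (cong push sum) push-∅)))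
    where
    open Embedding ends simple T f f-inj adj

    empty : ∀ {F} → map push F ≡ [] → F ≡ []
    empty {[]} _ = refl

    linked : Linked T (map push F)
    linked c∈ cx cy with S , S∈ , refl ← ∈-map⁻ push c∈
      with x , refl , Sx ← touches-push S cx | y , refl , Sy ← touches-push S cy with x ≟ y
    -- For equal vertices the required boundary vanishes and the empty chain serves.
    ... | yes refl = ∅ , (λ z → trans (∂-∅ (tends T) z) (sym (𝔹.xor-same (does (f x ≟ z))))) ,
                     λ _ _ _ t h → contradiction (trans (sym (lookup-∅ t)) h) λ ()
    ... | no x≢y = mod2 (map g (E P)) , ∂-walk P , within
      where
      open Lsp (lsp x≢y) renaming (path to P)

      within : ∀ {d} → d ∈ map push F → Touches T d (f x) → Touches T d (f y) → mod2 (map g (E P)) ⊑ d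
      within d∈ dx dy t h with S , S∈ , refl ← ∈-map⁻ push d∈
        with x′ , fx≡ , Sx ← touches-push S dx | y′ , fy≡ , Sy ← touches-push S dy
        with refl ← f-inj fx≡ | refl ← f-inj fy≡
        with e , e∈ , refl ← ∈-map⁻ g (mod2⇒∈ {xs = map g (E P)} h) =
        trans (lookup-push S e) (Vec.[]=⇒lookup (proj₂ (All.lookup good S∈) x y Sx Sy x≢y P isLSP e e∈))

-- Minimality

comb : (L : List (Subset m)) → Subset (length L) → Subset m
comb []      []      = ∅
comb (C ∷ L) (α ∷ p) = α · C ⊞ comb L p

comb-∅ : (L : List (Subset m)) → comb L ∅ ≡ ∅
comb-∅ []      = refl
comb-∅ (C ∷ L) = trans (⊞-identityˡ _) (comb-∅ L)

comb-⊞ : (L : List (Subset m)) (p q : Subset (length L)) → comb L (p ⊞ q) ≡ comb L p ⊞ comb L q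
comb-⊞ []      []      []      = sym (⊞-identityˡ ∅)
comb-⊞ (C ∷ L) (α ∷ p) (β ∷ q) = trans (cong₂ _⊞_ (·-⊞ α β C) (comb-⊞ L p q)) (⊞-interchange (α · C) _ _ _)

comb-⁅⁆ : (L : List (Subset m)) (i : Fin (length L)) → comb L ⁅ i ⁆ ≡ List.lookup L i
comb-⁅⁆ (C ∷ L) zero    = trans (cong (C ⊞_) (comb-∅ L)) (⊞-identityʳ C)
comb-⁅⁆ (C ∷ L) (suc i) = trans (⊞-identityˡ _) (comb-⁅⁆ L i)

-- Turns a coefficient vector into a sublist, so that independence stated for repetition-free lists
-- becomes linear independence.
pick : (L : List A) → Subset (length L) → List A
pick []      []          = []
pick (x ∷ L) (true  ∷ p) = x ∷ pick L p
pick (x ∷ L) (false ∷ p) = pick L p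

⨁-pick : (L : List (Subset m)) (p : Subset (length L)) → ⨁ (pick L p) ≡ comb L p
⨁-pick []      []          = refl
⨁-pick (C ∷ L) (true  ∷ p) = cong (C ⊞_) (⨁-pick L p)
⨁-pick (C ∷ L) (false ∷ p) = trans (⨁-pick L p) (sym (⊞-identityˡ _))

pick-All : {P : A → Set} {L : List A} → All P L → ∀ p → All P (pick L p)
pick-All []         []          = []
pick-All (px ∷ pxs) (true  ∷ p) = px ∷ pick-All pxs p
pick-All (px ∷ pxs) (false ∷ p) = pick-All pxs p

pick-Unique : {L : List A} → Unique L → ∀ p → Unique (pick L p)
pick-Unique []       []          = []
pick-Unique (x∉ ∷ u) (true  ∷ p) = pick-All x∉ p ∷ pick-Unique u p
pick-Unique (x∉ ∷ u) (false ∷ p) = pick-Unique u p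

pick≡[] : (L : List A) (p : Subset (length L)) → pick L p ≡ [] → p ≡ ∅
pick≡[] []      []          _  = refl
pick≡[] (x ∷ L) (false ∷ p) eq = cong (false ∷_) (pick≡[] L p eq)

lookup-weights : (f : A → ℕ) (L : List A) (i : Fin (length L)) →
                 lookup (Vec.map f (fromList L)) i ≡ f (List.lookup L i)
lookup-weights f (x ∷ L) zero    = refl
lookup-weights f (x ∷ L) (suc i) = lookup-weights f L i

sum-weights : (f : A → ℕ) (L : List A) → Vec.sum (Vec.map f (fromList L)) ≡ sum (map f L)
sum-weights f []      = refl
sum-weights f (x ∷ L) = cong (f x +_) (sum-weights f L)

module Comparison {n m : ℕ} (ends : Fin m → Fin n × Fin n) (f : Subset m → ℕ) (L : List (Subset m))
  (independent : ∀ p → comb L p ≡ ∅ → p ≡ ∅) where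

  private
    weights = Vec.map f (fromList L)

    Bounded : Row (length L) → Set
    Bounded r = ∀ i → lookup (proj₁ r) i ≡ true → lookup weights i ≤ proj₂ r

  -- A position surviving in a sum occurs in some summand, so cancellation cannot break the weight
  -- bound.
  coordinates : ∀ {W v} → Span ends (λ b → b ∈ L × f b ≤ W) v → ∃ λ p → comb L p ≡ v × Bounded (p , W)
  coordinates span-0 = ∅ , comb-∅ L , λ i h → contradiction (trans (sym (lookup-∅ i)) h) λ ()
  coordinates {W} (span-+ {b} (b∈ , b≤) s) with p , eq , bounded ← coordinates s =
    ⁅ i ⁆ ⊞ p , trans (comb-⊞ L ⁅ i ⁆ p) (cong₂ _⊞_ (trans (comb-⁅⁆ L i) (sym b≡)) eq) , bounded′
    where
    i = Any.index b∈
    b≡ : b ≡ List.lookup L i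
    b≡ = lookup-index b∈

    bounded′ : Bounded (⁅ i ⁆ ⊞ p , W)
    bounded′ j h with j ≟ i
    ... | yes refl = subst (_≤ W) (trans (cong f b≡) (sym (lookup-weights f L i))) b≤
    ... | no  j≢i  = bounded j (trans (sym (trans (lookup-⊞ ⁅ i ⁆ p j)
                       (cong (_xor lookup p j) (lookup-⁅⁆-≢ j≢i)))) h)

  private
    rows : ∀ {B} → All (λ b → Span ends (λ l → l ∈ L × f l ≤ f b) b) B →
      ∃ λ R → length R ≡ length B × sum (map proj₂ R) ≡ sum (map f B) × All Bounded R ×
              (∀ {b} → b ∈ B → ∃ λ r → r ∈ R × comb L (proj₁ r) ≡ b)
    rows []              = [] , refl , refl , [] , λ ()
    rows {b ∷ _} (s ∷ light) with p , eq , bounded ← coordinates s | R , ℓ≡ , W≡ , bR , represent ← rows light =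
      (p , f b) ∷ R , cong suc ℓ≡ , cong (f b +_) W≡ , bounded ∷ bR ,
      λ { (here refl) → (p , f b) , here refl , eq
        ; (there b∈)  → Product.map₂ (Product.map₁ there) (represent b∈) }

  -- The rows are the coordinates over L of the members of B. As B spans L, they have full column
  -- rank, and `exchange` applies.
  compare : (B : List (Subset m)) → (∀ {v} → v ∈ L → Span ends (_∈ B) v) →
    All (λ b → Span ends (λ l → l ∈ L × f l ≤ f b) b) B →
    length L ≤ length B × sum (map f L) ≤ sum (map f B)
  compare B spans light with R , ℓ≡ , W≡ , bounded , represent ← rows light =
    Product.map (subst (length L ≤_) ℓ≡) (subst₂ _≤_ (sum-weights f L) W≡) (exchange weights R bounded nondegenerate)
    where
    nondegenerate : ∀ y → All (λ r → ⟨ y , proj₁ r ⟩ ≡ false) R → y ≡ ∅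
    nondegenerate y kills = lookup-ext λ i → trans (sym (⟨⟩-⁅⁆ y i))
      (trans (annihilates (spans (∈-lookup i)) ⁅ i ⁆ (comb-⁅⁆ L i)) (sym (lookup-∅ i)))
      where
      -- Members of B are removed from v one at a time, each changing p by a row that y kills. What
      -- remains is a combination equal to ∅, where independence of L makes the coefficients zero.
      annihilates : ∀ {v} → Span ends (_∈ B) v → ∀ p → comb L p ≡ v → ⟨ y , p ⟩ ≡ false
      annihilates span-0 p eq = trans (cong ⟨ y ,_⟩ (independent p eq)) (⟨⟩-∅ y)
      annihilates (span-+ {b} {v} b∈ s) p eq with (r , _) , r∈ , r≡ ← represent b∈ = begin
        ⟨ y , p ⟩                  ≡⟨ cong (_xor ⟨ y , p ⟩) (All.lookup kills r∈) ⟨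
        ⟨ y , r ⟩ xor ⟨ y , p ⟩    ≡⟨ ⟨⟩-⊞ y r p ⟨
        ⟨ y , r ⊞ p ⟩              ≡⟨ annihilates s (r ⊞ p) (trans (comb-⊞ L r p)
                                        (trans (cong₂ _⊞_ r≡ eq) (⊞-cancel b v))) ⟩
        false                      ∎
        where open ≡-Reasoning

theorem2 : ∀ {n m : ℕ} (ends : Fin m → Fin n × Fin n) (w : Fin m → ℕ)
    (_≺_ : Fin n → Fin n → Set) → IsStrictTotalOrder _≡_ _≺_ →
    Simple ends → Connected ends → PartialTwoTree ends →
    (L : List (Subset m)) → Unique L →
    (∀ S → (S ∈ L) ⇔ (IsCycle ends S × LexShort ends w _≺_ S)) →
    IsMinimumCycleBasis ends w L
theorem2 {n} {m} ends w _≺_ sto simple connected partial L uniq L⇔ =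
  ((uniq , All.map proj₁ good) , spansL , λ B (_ , cycles) spansB → proj₁ (compareL B cycles spansB)) ,
  λ B ((_ , cycles) , spansB , _) → proj₂ (compareL B cycles spansB)
  where
  open Spanning ends w _≺_ sto simple connected L L⇔

  good : All (λ S → IsCycle ends S × LexShort ends w _≺_ S) L
  good = All.tabulate λ {S} S∈ → Equivalence.to (L⇔ S) S∈

  spansL : Spans ends L
  spansL v = span-bind ends λ cyc → span-bind ends (span-member ends ∘ proj₁) (spanned cyc)

  independentL : ∀ p → comb L p ≡ ∅ → p ≡ ∅
  independentL p eq = pick≡[] L p (lexShort-independent ends w _≺_ sto simple connected partial
    (pick L p) (pick-Unique uniq p) (pick-All good p) (trans (⨁-pick L p) eq))

  compareL : ∀ B → All (IsCycle ends) B → Spans ends B →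
    length L ≤ length B × totalWeight ends w L ≤ totalWeight ends w B
  compareL B cycles spansB = Comparison.compare ends (cweight ends w) L independentL B
    (λ v∈ → spansB _ (span-member ends (proj₁ (All.lookup good v∈)))) (All.map spanned cycles)
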